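{- Let $n\ge2$, $1\le p\le n$ and $r\in[n+1]$. If $r\le n-p+1$ and $p\le n-1$, then $|\mathcal{T}_n^{(r,p)}|=\sum_{i=r}^{n}|\mathcal{T}_{n-1}^{(i,p)}|$. If $r>n-p+1$ and $p\ge2$, then $|\mathcal{T}_n^{(r,p)}|=\sum_{i=1}^{r-1}|\mathcal{T}_{n-1}^{(i,p-1)}|$.
   Context: For $\pi\in S_n$, $r\in[n+1]$, $1\le p\le n$, the configuration $\pi^{(r,p)}$ on sites $\{0,\dots,n+1\}$ places on site $i$ ($1\le i\le n$) the chip $\pi_i$ if $\pi_i<r$ and $\pi_i+1$ otherwise, plus an extra chip $r$ on site $p$. Toppling: while a site $i$ has at least two chips, pick two chips $\alpha<\beta$ there and move $\alpha$ to $i-1$, $\beta$ to $i+1$; the final configuration is independent of choices, with one chip per site but one. $\mathcal{T}_n^{(r,p)}$ is the set of $\pi\in S_n$ for which the chips of the final configuration from $\pi^{(r,p)}$, read left to right, are $1,2,\dots,n+1$ (defined only for $1\le p\le n$). -}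

module Defs where

open import Data.Nat using (ℕ; zero; suc; _+_; _∸_; _≤_; _<_; _≤ᵇ_; _≡ᵇ_; _^_)
open import Data.Nat.Properties using (_≟_; _≤?_)
open import Data.Bool using (Bool; true; false; if_then_else_)
open import Data.List using (List; []; _∷_; _++_; map; concat; concatMap; length; filter; upTo)
open import Data.Nat.ListAction using (sum)
open import Data.List.Properties using (≡-dec)
open import Data.List.Relation.Unary.All using (All)
open import Data.List.Relation.Unary.All as All using (all?)
open import Data.List.Relation.Unary.Unique.Propositional using (Unique)
open import Data.List.Relation.Unary.Unique.DecPropositional _≟_ using (unique?)
open import Data.Maybe using (Maybe; just; nothing)
open import Data.Product using (_×_; _,_)
open import Relation.Binary.PropositionalEquality using (_≡_)
open import Relation.Nullary using (Dec; yes; no)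
open import Relation.Nullary.Decidable using (_×-dec_)

-- [a..b] = a, a+1, …, b  (empty if b < a)
range : ℕ → ℕ → List ℕ
range a b = map (a +_) (upTo (suc b ∸ a))

words : ℕ → ℕ → List (List ℕ)
words n zero    = [] ∷ []
words n (suc k) = concatMap (λ x → map (x ∷_) (words n k)) (range 1 n)

Sym : ℕ → List (List ℕ)
Sym n = filter unique? (words n n)

-- Labelled chip configurations on a line.  A configuration is the list of
-- sites from left to right; each site holds the (sorted) list of labels of
-- its chips.  The line is unbounded: if a boundary site topples, a new
-- site is created beyond it.

Site : Set
Site = List ℕ

Config : Set
Config = List Site

ins : ℕ → Site → Site
ins a []       = a ∷ []
ins a (b ∷ bs) = if a ≤ᵇ b then a ∷ b ∷ bs else b ∷ ins a bs

addHead : ℕ → Config → Config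
addHead b []       = (b ∷ []) ∷ []
addHead b (t ∷ ts) = ins b t ∷ ts

-- One toppling at the leftmost site with ≥ 2 chips: the two smallest
-- chips α < β there move, α one site left and β one site right.
-- Given the left neighbour l of the remaining sites, returns the new left
-- neighbour and new remaining sites; nothing if no site topples.
fireAt : Site → Config → Maybe (Site × Config)
fireAt l []                      = nothing
fireAt l ((a ∷ b ∷ s) ∷ rest)   = just (ins a l , s ∷ addHead b rest)
fireAt l (s ∷ rest) with fireAt s rest
... | nothing          = nothing
... | just (s' , rest') = just (l , s' ∷ rest')

fire : Config → Maybe Config
fire []                    = nothing
fire ((a ∷ b ∷ s) ∷ rest) = just ((a ∷ []) ∷ s ∷ addHead b rest)
fire (s ∷ rest) with fireAt s rest
... | nothing           = nothing
... | just (s' , rest') = just (s' ∷ rest')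

stabilize : ℕ → Config → Config
stabilize zero    c = c
stabilize (suc k) c with fire c
... | nothing = c
... | just c' = stabilize k c'

-- The fuel (n+2)^3 is more than enough: each toppling raises
-- Σ (position)² by exactly 2, and all positions stay in {0,…,n+1}
-- with n+1 chips, so at most (n+1)³/2 topplings occur.
fuel : ℕ → ℕ
fuel n = (n + 2) ^ 3

relabel : ℕ → ℕ → ℕ
relabel r x = if suc x ≤ᵇ r then x else suc x

inner : ℕ → ℕ → ℕ → List ℕ → Config
inner r p i []       = []
inner r p i (x ∷ xs) =
  (if i ≡ᵇ p then ins r (relabel r x ∷ []) else relabel r x ∷ [])
  ∷ inner r p (suc i) xs

initial : ℕ → ℕ → List ℕ → Config
initial r p π = [] ∷ (inner r p 1 π ++ ([] ∷ []))

final : ℕ → ℕ → ℕ → List ℕ → Config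
final n r p π = stabilize (fuel n) (initial r p π)

Stable : Config → Set
Stable c = All (λ s → length s ≤ 1) c

InT : ℕ → ℕ → ℕ → List ℕ → Set
InT n r p π = Stable (final n r p π) × (concat (final n r p π) ≡ range 1 (suc n))

InT? : ∀ n r p π → Dec (InT n r p π)
InT? n r p π = all? (λ s → length s ≤? 1) (final n r p π)
           ×-dec ≡-dec _≟_ (concat (final n r p π)) (range 1 (suc n))

cardT : ℕ → ℕ → ℕ → ℕ
cardT n r p = length (filter (InT? n r p) (Sym n))

sumRange : ℕ → ℕ → (ℕ → ℕ) → ℕ
sumRange a b f = sum (map f (range a b))

{-# OPTIONS --safe #-}

-- Put h = n + 1 - p.  Leftmost toppling consists of h passes, each moving
-- an extra chip leftwards through p sites and leaving the larger chip one
-- site to the right at every step.  Chips entering later passes (sites to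
-- the right of p) can only be lowered and chips on the first p sites can
-- only be raised, so a sorted outcome forces -p < w_j - j ≤ h for the
-- relabelled chip w_j of every site j; conversely these inequalities make
-- every pass emit the smallest remaining chip.
--
-- It remains to count the π satisfying the inequalities.  If r < h, those
-- for r + 1 are those for r with π_{r+p} ≠ r, and deleting site r + p from
-- the others leaves a permutation of [n-1] satisfying the inequalities for
-- (p, h-1, r).  If r = h, delete the last site, whose chip satisfies
-- π_n ≥ h.  For r > h, delete site r - 1 - h, or the first site if
-- r = h + 1.
module Submission where

open import Defs
open import Data.Nat
  using (ℕ; zero; suc; _+_; _*_; _∸_; _⊓_; _⊔_; _≤_; _<_; _≤ᵇ_; _<ᵇ_; _≡ᵇ_; z≤n; s≤s;
         z<s; s≤s⁻¹)
open import Data.Nat.Properties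
  using (*-identityʳ; *-identityˡ; *-mono-≤; +-assoc; +-cancelʳ-<; +-cancelʳ-≡;
         +-cancelʳ-≤; +-cancelˡ-≡; +-cancelˡ-≤; +-comm; +-identityʳ; +-mono-≤;
         +-monoʳ-≤; +-monoˡ-<; +-monoˡ-≤; +-suc; +-∸-assoc; <-cmp; <-irrefl; <-trans;
         <⇒≢; <⇒≤; <⇒≱; m+[n∸m]≡n; m<m+n; m∸n+n≡m; m≤m+n; m≤n+m; m≤n⇒m∸n≡0; m≤n⇒m≤1+n;
         m≤n⇒m⊓n≡m; m≤n⇒m⊔n≡n; m≤n⇒∃[o]m+o≡n; m≥n⇒m⊓n≡n; m≥n⇒m⊔n≡m; n<1+n; n≤1+n;
         suc-injective; ≡ᵇ⇒≡; ≡⇒≡ᵇ; ≤-<-trans; ≤-antisym; ≤-refl; ≤-reflexive; ≤-total;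
         ≤-trans; ≤ᵇ⇒≤; ≤⇒≤ᵇ; ≤⇒≯; ≤∧≢⇒<; ≮⇒≥; ≰⇒≥; m⊓n≤m; m⊓n≤n; m≤n⊔m; ⊓-comm;
         ⊔-comm; ⊔-lub; ⊓-sel; _≟_; _≤?_; _<?_)
open import Data.Nat.ListAction using (sum)
open import Data.Nat.ListAction.Properties using (sum-++)
open import Data.Bool using (true; false; T)
open import Data.List.Base
  using (List; []; _∷_; _++_; _ʳ++_; map; concat; concatMap; length; reverse; filter;
         applyUpTo; cartesianProductWith)
open import Data.List.Properties
  using (length-map; length-++; length-reverse; ++-identityʳ; ++-assoc; map-upTo;
         map-cong-local; map-injective; map-++; unfold-reverse; reverse-involutive;
         reverse-map; ∷-injective; ʳ++-defn; ++-ʳ++; concat-++; concat-map-[_])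
open import Data.List.Membership.Propositional using (_∈_)
open import Data.List.Membership.Propositional.Properties
  using (∈-∃++; ∈-++⁻; ∈-filter⁺; ∈-filter⁻; ∈-cartesianProductWith⁺;
         ∈-cartesianProductWith⁻; ∈-map∘filter⁺; ∈-map∘filter⁻)
open import Data.List.Relation.Unary.Any using (here; there)
open import Data.List.Relation.Unary.All as All using (All; []; _∷_)
import Data.List.Relation.Unary.All.Properties as All
open import Data.List.Relation.Unary.AllPairs using ([]; _∷_)
open import Data.List.Relation.Unary.Unique.Propositional using (Unique)
import Data.List.Relation.Unary.Unique.Propositional.Properties as Unique
open import Data.List.Relation.Unary.Unique.DecPropositional _≟_ using (unique?)
open import Data.List.Relation.Binary.Permutation.Propositional
  using (_↭_; ↭-refl; ↭-sym; ↭-trans; ↭-reflexive; prep; swap; ↭⇒↭ₛ)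
open import Data.List.Relation.Binary.Permutation.Propositional.Properties
  using (All-resp-↭; ∈-resp-↭; ↭-length; shift; drop-∷; ∷↭∷ʳ; ↭-reverse; ++-comm; ++⁺ˡ; ++⁺ʳ)
import Data.List.Relation.Binary.Permutation.Setoid.Properties as ↭ₛ
open import Data.Maybe.Base using (just; nothing)
open import Data.Product using (_×_; _,_; proj₁; proj₂; ∃; map₁; map₂)
open import Data.Product.Function.NonDependent.Propositional using (_×-⇔_)
open import Data.Sum using (inj₁; inj₂)
open import Data.Unit using (⊤; tt)
open import Function using (_∘_; _⇔_; mk⇔; Equivalence)
open import Function.Construct.Composition using (_⇔-∘_)
open import Function.Construct.Identity using (⇔-id)
open import Function.Construct.Symmetry using (⇔-sym)
open import Level using (0ℓ)
open import Relation.Binary.Definitions using (tri<; tri≈; tri>)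
open import Relation.Binary.PropositionalEquality
open import Relation.Nullary using (¬_; Dec; yes; no; ¬?; contradiction)
open import Relation.Nullary.Decidable using (_×-dec_)
open import Relation.Unary using (Pred; Decidable)

private variable
  A : Set
  P Q : Pred A 0ℓ

-- Counting in duplicate-free lists

Unique-resp-↭ : {xs ys : List A} → xs ↭ ys → Unique xs → Unique ys
Unique-resp-↭ p = ↭ₛ.Unique-resp-↭ (setoid _) (↭⇒↭ₛ p)

-- Each element of `xs` is cut out of `ys` at one occurrence; by uniqueness the later elements of
-- `xs` survive the cut. The pigeonhole facts below compare lengths through the remainder `zs`.
unique-⊆-↭ : {xs ys : List A} → Unique xs → (∀ {x} → x ∈ xs → x ∈ ys) → ∃ λ zs → ys ↭ xs ++ zs
unique-⊆-↭ {xs = []} {ys} _ _ = ys , ↭-refl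
unique-⊆-↭ {xs = x ∷ xs} (x∉ ∷ u) xs⊆ys with ∈-∃++ (xs⊆ys (here refl))
... | as , bs , refl = map₂ (λ p → ↭-trans (shift x as bs) (prep x p)) (unique-⊆-↭ u ⊆′)
  where
  ⊆′ : ∀ {y} → y ∈ xs → y ∈ as ++ bs
  ⊆′ y∈ with ∈-resp-↭ (shift x as bs) (xs⊆ys (there y∈))
  ... | here refl = contradiction refl (All.lookup x∉ y∈)
  ... | there y∈′ = y∈′

unique-⊆-length-↭ : {xs ys : List A} → Unique xs → (∀ {x} → x ∈ xs → x ∈ ys) →
                    length xs ≡ length ys → xs ↭ ys
unique-⊆-length-↭ {xs = xs} u ⊆ eq with unique-⊆-↭ u ⊆
... | [] , p = ↭-sym (↭-trans p (↭-reflexive (++-identityʳ xs)))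
... | z ∷ zs , p = contradiction
  (trans eq (trans (↭-length p) (↭-length (shift z xs zs))))
  (<⇒≢ (s≤s (subst (length xs ≤_) (sym (length-++ xs)) (m≤m+n _ _))))

unique-⊆-length-≤ : {xs ys : List A} → Unique xs → (∀ {x} → x ∈ xs → x ∈ ys) → length xs ≤ length ys
unique-⊆-length-≤ {xs = xs} u ⊆ with unique-⊆-↭ u ⊆
... | zs , p = subst (length xs ≤_) (sym (trans (↭-length p) (length-++ xs))) (m≤m+n _ _)

count : {P : Pred A 0ℓ} → Decidable P → List A → ℕ
count P? xs = length (filter P? xs)

count-cong : (P? : Decidable P) (Q? : Decidable Q) (xs : List A) →
             (∀ {x} → x ∈ xs → P x ⇔ Q x) → count P? xs ≡ count Q? xs
count-cong P? Q? [] _ = refl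
count-cong P? Q? (x ∷ xs) P⇔Q with P? x | Q? x
... | yes _ | yes _ = cong suc (count-cong P? Q? xs (P⇔Q ∘ there))
... | yes p | no ¬q = contradiction (Equivalence.to (P⇔Q (here refl)) p) ¬q
... | no ¬p | yes q = contradiction (Equivalence.from (P⇔Q (here refl)) q) ¬p
... | no _  | no _  = count-cong P? Q? xs (P⇔Q ∘ there)

count-split : (P? : Decidable P) (Q? : Decidable Q) (xs : List A) →
  count P? xs ≡ count (λ x → P? x ×-dec ¬? (Q? x)) xs + count (λ x → P? x ×-dec Q? x) xs
count-split P? Q? [] = refl
count-split P? Q? (x ∷ xs) with P? x | Q? x
... | yes _ | yes _ = trans (cong suc (count-split P? Q? xs)) (sym (+-suc _ _))
... | yes _ | no _  = cong suc (count-split P? Q? xs)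
... | no _  | yes _ = count-split P? Q? xs
... | no _  | no _  = count-split P? Q? xs

-- The fibre over `v` is split off and the induction goes on with `P` narrowed to `f x ≢ v`. Since
-- `v` does not recur in `vs`, the narrowing leaves the other fibres unchanged.
count-fibres : (P? : Decidable P) (f : A → ℕ) (vs : List ℕ) (xs : List A) → Unique vs →
  (∀ {x} → x ∈ xs → P x → f x ∈ vs) →
  count P? xs ≡ sum (map (λ v → count (λ x → P? x ×-dec (f x ≟ v)) xs) vs)
count-fibres P? f [] [] _ _ = refl
count-fibres P? f [] (x ∷ xs) u h with P? x
... | yes p = contradiction (h (here refl) p) λ ()
... | no _  = count-fibres P? f [] xs u (h ∘ there)
count-fibres {P = P} P? f (v ∷ vs) xs (v∉ ∷ u) h = begin
  count P? xs
    ≡⟨ count-split P? (λ x → f x ≟ v) xs ⟩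
  count P≢? xs + c v
    ≡⟨ +-comm _ (c v) ⟩
  c v + count P≢? xs
    ≡⟨ cong (c v +_) (count-fibres P≢? f vs xs u h′) ⟩
  c v + sum (map (λ w → count (λ x → P≢? x ×-dec (f x ≟ w)) xs) vs)
    ≡⟨ cong (λ ns → c v + sum ns) (map-cong-local (All.map drop-≢ v∉)) ⟩
  c v + sum (map c vs) ∎
  where
  open ≡-Reasoning
  P≢? = λ x → P? x ×-dec ¬? (f x ≟ v)
  c = λ w → count (λ x → P? x ×-dec (f x ≟ w)) xs
  h′ : ∀ {x} → x ∈ xs → P x × f x ≢ v → f x ∈ vs
  h′ x∈ (p , ≢v) with h x∈ p
  ... | here ≡v = contradiction ≡v ≢v
  ... | there fx∈ = fx∈
  drop-≢ : ∀ {w} → v ≢ w → count (λ x → P≢? x ×-dec (f x ≟ w)) xs ≡ c w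
  drop-≢ v≢w = count-cong _ _ xs λ _ →
    mk⇔ (λ { ((p , _) , e) → p , e }) (λ (p , e) → (p , λ e′ → v≢w (trans (sym e′) e)) , e)

-- Integer intervals and permutations as words

-- An interval given by start and length, for structural recursion in place of `upTo` and truncated
-- subtraction.
from : ℕ → ℕ → List ℕ
from s zero    = []
from s (suc k) = s ∷ from (suc s) k

range≡from : ∀ a b → range a b ≡ from a (suc b ∸ a)
range≡from a b = trans (map-upTo (a +_) _) (applyUpTo≡from (a +_) a (suc b ∸ a) (λ _ → refl))
  where
  applyUpTo≡from : ∀ f a k → (∀ i → f i ≡ a + i) → applyUpTo f k ≡ from a k
  applyUpTo≡from f a zero    _ = refl
  applyUpTo≡from f a (suc k) e = cong₂ _∷_ (trans (e 0) (+-identityʳ a))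
    (applyUpTo≡from (f ∘ suc) (suc a) k λ i → trans (e (suc i)) (+-suc a i))

length-from : ∀ s k → length (from s k) ≡ k
length-from s zero    = refl
length-from s (suc k) = cong suc (length-from (suc s) k)

∈-from⁺ : ∀ {s x} k → s ≤ x → x < s + k → x ∈ from s k
∈-from⁺ {s} {x} zero    s≤x x< =
  contradiction (≤-<-trans s≤x (subst (x <_) (+-identityʳ s) x<)) (<-irrefl refl)
∈-from⁺ {s} {x} (suc k) s≤x x< with s ≟ x
... | yes refl = here refl
... | no s≢x   = there (∈-from⁺ k (≤∧≢⇒< s≤x s≢x) (subst (x <_) (+-suc s k) x<))

∈-from⁻ : ∀ {s x} k → x ∈ from s k → s ≤ x × x < s + k
∈-from⁻ {s} (suc k) (here refl) = ≤-refl , m<m+n s z<s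
∈-from⁻ {s} {x} (suc k) (there x∈) with ∈-from⁻ k x∈
... | s<x , x< = <⇒≤ s<x , subst (x <_) (sym (+-suc s k)) x<

from-unique : ∀ s k → Unique (from s k)
from-unique s zero    = []
from-unique s (suc k) =
  All.tabulate (λ x∈ → <⇒≢ (proj₁ (∈-from⁻ k x∈))) ∷ from-unique (suc s) k

from-∷ʳ : ∀ s k → from s (suc k) ≡ from s k ++ s + k ∷ []
from-∷ʳ s zero    = cong (_∷ []) (sym (+-identityʳ s))
from-∷ʳ s (suc k) = cong (s ∷_)
  (trans (from-∷ʳ (suc s) k) (cong (λ m → from (suc s) k ++ m ∷ []) (sym (+-suc s k))))

∈-range⁺ : ∀ {a b x} → a ≤ x → x ≤ b → x ∈ range a b
∈-range⁺ {a} {b} {x} a≤x x≤b = subst (x ∈_) (sym (range≡from a b))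
  (∈-from⁺ _ a≤x (subst (x <_) (sym (m+[n∸m]≡n (≤-trans a≤x (m≤n⇒m≤1+n x≤b)))) (s≤s x≤b)))

∈-range⁻ : ∀ {a b x} → x ∈ range a b → a ≤ x × x ≤ b
∈-range⁻ {a} {b} {x} x∈ with ∈-from⁻ _ (subst (x ∈_) (range≡from a b) x∈) | ≤-total a (suc b)
... | a≤x , x< | inj₁ a≤b = a≤x , s≤s⁻¹ (subst (x <_) (m+[n∸m]≡n a≤b) x<)
... | a≤x , x< | inj₂ b<a = contradiction (≤-<-trans a≤x
        (subst (x <_) (trans (cong (a +_) (m≤n⇒m∸n≡0 b<a)) (+-identityʳ a)) x<)) (<-irrefl refl)

range-unique : ∀ a b → Unique (range a b)
range-unique a b = Unique.map⁺ (+-cancelˡ-≡ a _ _) (Unique.upTo⁺ _)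

words-suc : ∀ n k → words n (suc k) ≡ cartesianProductWith _∷_ (range 1 n) (words n k)
words-suc n k = go (range 1 n)
  where
  go : ∀ xs → concatMap (λ x → map (x ∷_) (words n k)) xs ≡ cartesianProductWith _∷_ xs (words n k)
  go []       = refl
  go (x ∷ xs) = cong (map (x ∷_) (words n k) ++_) (go xs)

words-unique : ∀ n k → Unique (words n k)
words-unique n zero    = [] ∷ []
words-unique n (suc k) = subst Unique (sym (words-suc n k))
  (Unique.cartesianProductWith⁺ _∷_ (λ { refl → refl , refl })
    (range-unique 1 n) (words-unique n k))

InRange : ℕ → Pred ℕ 0ℓ
InRange n x = 1 ≤ x × x ≤ n

∈-words⁺ : ∀ {n π} k → All (InRange n) π → length π ≡ k → π ∈ words n k
∈-words⁺ zero [] refl = here refl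
∈-words⁺ {n} (suc k) ((1≤x , x≤n) ∷ π∈) refl = subst (_ ∈_) (sym (words-suc n k))
  (∈-cartesianProductWith⁺ _∷_ (∈-range⁺ 1≤x x≤n) (∈-words⁺ k π∈ refl))

∈-words⁻ : ∀ {n π} k → π ∈ words n k → All (InRange n) π × length π ≡ k
∈-words⁻ zero (here refl) = [] , refl
∈-words⁻ {n} {π} (suc k) π∈
  with ∈-cartesianProductWith⁻ _∷_ (range 1 n) (words n k) (subst (π ∈_) (words-suc n k) π∈)
... | x , xs , x∈ , xs∈ , refl with ∈-words⁻ k xs∈
... | all , refl = (∈-range⁻ x∈ ∷ all) , refl

Perm : ℕ → Pred (List ℕ) 0ℓ
Perm n π = Unique π × All (InRange n) π × length π ≡ n

∈-Sym⁺ : ∀ {n π} → Perm n π → π ∈ Sym n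
∈-Sym⁺ {n} (u , a , l) = ∈-filter⁺ unique? (∈-words⁺ n a l) u

∈-Sym⁻ : ∀ {n π} → π ∈ Sym n → Perm n π
∈-Sym⁻ {n} π∈ with ∈-filter⁻ unique? {xs = words n n} π∈
... | π∈w , u = u , ∈-words⁻ n π∈w

Sym-unique : ∀ n → Unique (Sym n)
Sym-unique n = Unique.filter⁺ unique? (words-unique n n)

Perm-↭ : ∀ {n π} → Perm n π → π ↭ from 1 n
Perm-↭ {n} (u , a , l) = unique-⊆-length-↭ u
  (λ x∈ → let 1≤x , x≤n = All.lookup a x∈ in ∈-from⁺ n 1≤x (s≤s x≤n))
  (trans l (sym (length-from 1 n)))

-- Relabelling around a missing value

-- `relabel r` is the increasing bijection from the naturals onto the naturals other than `r`. The
-- view delivers its value together with the inequality that selects it.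
data Relabel (r x : ℕ) : ℕ → Set where
  below : x < r → Relabel r x x
  above : r ≤ x → Relabel r x (suc x)

relabelView : ∀ r x → Relabel r x (relabel r x)
relabelView r x with suc x ≤ᵇ r in eq
... | true  = below (≤ᵇ⇒≤ (suc x) r (subst T (sym eq) tt))
... | false = above (≮⇒≥ λ x<r → subst T eq (≤⇒≤ᵇ x<r))

relabel-below : ∀ {r x} → x < r → relabel r x ≡ x
relabel-below {r} {x} x<r with relabel r x | relabelView r x
... | _ | below _   = refl
... | _ | above r≤x = contradiction x<r (≤⇒≯ r≤x)

relabel-above : ∀ {r x} → r ≤ x → relabel r x ≡ suc x
relabel-above {r} {x} r≤x with relabel r x | relabelView r x
... | _ | below x<r = contradiction x<r (≤⇒≯ r≤x)
... | _ | above _   = refl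

relabel-injective : ∀ r {x y} → relabel r x ≡ relabel r y → x ≡ y
relabel-injective r {x} {y} eq with relabel r x | relabelView r x | relabel r y | relabelView r y
relabel-injective r eq | _ | below _ | _ | below _ = eq
relabel-injective r refl | _ | below x<r | _ | above r≤y =
  contradiction (<-trans (n<1+n _) x<r) (≤⇒≯ r≤y)
relabel-injective r refl | _ | above r≤x | _ | below y<r =
  contradiction (<-trans (n<1+n _) y<r) (≤⇒≯ r≤x)
relabel-injective r refl | _ | above _ | _ | above _ = refl

relabel≢ : ∀ r x → r ≢ relabel r x
relabel≢ r x eq with relabel r x | relabelView r x
... | _ | below x<r = <⇒≢ x<r (sym eq)
... | _ | above r≤x = <⇒≢ (s≤s r≤x) eq

relabel-InRange : ∀ {n} r {x} → InRange n x → InRange (suc n) (relabel r x)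
relabel-InRange r {x} (1≤x , x≤n) with relabel r x | relabelView r x
... | _ | below _ = 1≤x , m≤n⇒m≤1+n x≤n
... | _ | above _ = m≤n⇒m≤1+n 1≤x , s≤s x≤n

relabel-surjective : ∀ {n v x} → InRange (suc n) v → InRange (suc n) x → v ≢ x →
                     ∃ λ y → InRange n y × x ≡ relabel v y
relabel-surjective {x = x} (_ , v≤n) (1≤x , _) v≢x with <-cmp x _
... | tri< x<v _ _ = x , (1≤x , s≤s⁻¹ (≤-trans x<v v≤n)) , sym (relabel-below x<v)
... | tri≈ _ x≡v _ = contradiction (sym x≡v) v≢x
relabel-surjective {x = suc y} (1≤v , _) (_ , x≤n) _ | tri> _ _ (s≤s v≤y) =
  y , (≤-trans 1≤v v≤y , s≤s⁻¹ x≤n) , sym (relabel-above v≤y)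

Perm-relabel : ∀ {n v π} → InRange (suc n) v → Perm n π → Perm (suc n) (v ∷ map (relabel v) π)
Perm-relabel {n} {v} {π} v∈ (u , a , l) =
  All.map⁺ (All.universal (relabel≢ v) π) ∷ Unique.map⁺ (relabel-injective v) u ,
  v∈ ∷ All.map⁺ (All.map (relabel-InRange v) a) ,
  cong suc (trans (length-map _ π) l)

-- The entries of `xs` differ from `v`, so each lies in the image of `relabel v`.
Perm-relabel⁻ : ∀ {n v xs} → Perm (suc n) (v ∷ xs) → ∃ λ π → Perm n π × xs ≡ map (relabel v) π
Perm-relabel⁻ {n} {v} (v∉ ∷ u , v∈ ∷ a , l) with go v∉ a
  where
  go : ∀ {xs} → All (v ≢_) xs → All (InRange (suc n)) xs →
       ∃ λ π → All (InRange n) π × xs ≡ map (relabel v) π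
  go [] [] = [] , [] , refl
  go (v≢x ∷ v∉) (x∈ ∷ a) with go v∉ a | relabel-surjective v∈ x∈ v≢x
  ... | π , a′ , refl | y , y∈ , refl = y ∷ π , y∈ ∷ a′ , refl
... | π , a′ , refl =
  π , (Unique.map⁻ u , a′ , trans (sym (length-map _ π)) (suc-injective l)) , refl

Perm-resp-↭ : ∀ {n xs ys} → xs ↭ ys → Perm n xs → Perm n ys
Perm-resp-↭ p (u , a , l) = Unique-resp-↭ p u , All-resp-↭ p a , trans (sym (↭-length p)) l

-- Inserting and deleting one entry of a permutation

insert : ℕ → A → List A → List A
insert zero    v xs       = v ∷ xs
insert (suc k) v []       = v ∷ []
insert (suc k) v (x ∷ xs) = x ∷ insert k v xs

insert-↭ : ∀ k (v : A) xs → insert k v xs ↭ v ∷ xs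
insert-↭ zero    v xs       = ↭-refl
insert-↭ (suc k) v []       = ↭-refl
insert-↭ (suc k) v (x ∷ xs) = ↭-trans (prep x (insert-↭ k v xs)) (swap x v ↭-refl)

insert-injective : ∀ k (v : A) {xs ys} → insert k v xs ≡ insert k v ys → xs ≡ ys
insert-injective zero v refl = refl
insert-injective (suc k) v {[]} {[]} _ = refl
insert-injective (suc k) v {x ∷ xs} {y ∷ ys} eq =
  let x≡y , eq′ = ∷-injective eq in cong₂ _∷_ x≡y (insert-injective k v eq′)
insert-injective (suc k) v {[]} {y ∷ ys} eq =
  contradiction (trans (cong length eq) (↭-length (insert-↭ (suc k) v (y ∷ ys)))) λ ()
insert-injective (suc k) v {x ∷ xs} {[]} eq =
  contradiction (trans (cong length (sym eq)) (↭-length (insert-↭ (suc k) v (x ∷ xs)))) λ ()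

-- The junk value 0 beyond the end is harmless, as chips are positive.
nth : ℕ → List ℕ → ℕ
nth k       []       = 0
nth zero    (x ∷ xs) = x
nth (suc k) (x ∷ xs) = nth k xs

nth-insert : ∀ k v xs → k ≤ length xs → nth k (insert k v xs) ≡ v
nth-insert zero    v xs       _         = refl
nth-insert (suc k) v (x ∷ xs) (s≤s k≤l) = nth-insert k v xs k≤l

insert-nth : ∀ k xs → k < length xs → ∃ λ ys → xs ≡ insert k (nth k xs) ys
insert-nth zero    (x ∷ xs) _ = xs , refl
insert-nth (suc k) (x ∷ xs) (s≤s k<l) with insert-nth k xs k<l
... | ys , eq = x ∷ ys , cong (x ∷_) eq

-- The inverse of deleting position `k` and standardising the rest: `relabel v` opens a gap in the
-- values for `v`.
graft : ℕ → ℕ → List ℕ → List ℕ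
graft k v π = insert k v (map (relabel v) π)

Perm-graft : ∀ {n v π} k → InRange (suc n) v → Perm n π → Perm (suc n) (graft k v π)
Perm-graft {v = v} {π} k v∈ p =
  Perm-resp-↭ (↭-sym (insert-↭ k v (map (relabel v) π))) (Perm-relabel v∈ p)

Perm-graft⁻ : ∀ {n π} k → k ≤ n → Perm (suc n) π → ∃ λ π′ → Perm n π′ × π ≡ graft k (nth k π) π′
Perm-graft⁻ {n} {π} k k≤n p@(_ , _ , l) with insert-nth k π (subst (k <_) (sym l) (s≤s k≤n))
... | ys , eq
  with Perm-relabel⁻ (Perm-resp-↭ (↭-trans (↭-reflexive eq) (insert-↭ k (nth k π) ys)) p)
... | π′ , p′ , refl = π′ , p′ , eq

unique-set-length : {xs ys : List A} → Unique xs → Unique ys →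
                    (∀ {x} → x ∈ xs ⇔ x ∈ ys) → length xs ≡ length ys
unique-set-length u u′ h =
  ≤-antisym (unique-⊆-length-≤ u (Equivalence.to h)) (unique-⊆-length-≤ u′ (Equivalence.from h))

-- On permutations of `[n]`, `graft k v` is injective and hits exactly the permutations of `[n+1]`
-- with `v` at position `k`. Both lists compared are duplicate-free, so equal membership gives equal
-- length.
count-graft : ∀ {P Q : Pred (List ℕ) 0ℓ} (P? : Decidable P) (Q? : Decidable Q) {n} k v →
  k ≤ n → InRange (suc n) v →
  (∀ {π} → Perm n π → P (graft k v π) ⇔ Q π) →
  count (λ π → P? π ×-dec (nth k π ≟ v)) (Sym (suc n)) ≡ count Q? (Sym n)
count-graft {P} {Q} P? Q? {n} k v k≤n v∈ P⇔Q = begin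
  length (filter P≡? (Sym (suc n)))
    ≡⟨ unique-set-length (Unique.filter⁺ P≡? (Sym-unique (suc n)))
         (Unique.map⁺ (map-injective (relabel-injective v) ∘ insert-injective k v)
           (Unique.filter⁺ Q? (Sym-unique n)))
         (mk⇔ ⊆ ⊇) ⟩
  length (map (graft k v) (filter Q? (Sym n)))
    ≡⟨ length-map _ (filter Q? (Sym n)) ⟩
  count Q? (Sym n) ∎
  where
  open ≡-Reasoning
  P≡? = λ π → P? π ×-dec (nth k π ≟ v)
  ⊆ : ∀ {π} → π ∈ filter P≡? (Sym (suc n)) → π ∈ map (graft k v) (filter Q? (Sym n))
  ⊆ {π} π∈ with ∈-filter⁻ P≡? {xs = Sym (suc n)} π∈
  ... | π∈S , Pπ , refl with Perm-graft⁻ k k≤n (∈-Sym⁻ π∈S)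
  ... | π′ , p′ , eq =
    ∈-map∘filter⁺ (graft k v) Q?
      (π′ , ∈-Sym⁺ p′ , eq , Equivalence.to (P⇔Q p′) (subst P eq Pπ))
  ⊇ : ∀ {π} → π ∈ map (graft k v) (filter Q? (Sym n)) → π ∈ filter P≡? (Sym (suc n))
  ⊇ π∈ with ∈-map∘filter⁻ (graft k v) Q? {xs = Sym n} π∈
  ... | π′ , π′∈ , refl , Qπ′ =
    ∈-filter⁺ P≡? (∈-Sym⁺ (Perm-graft k v∈ p′))
      (Equivalence.from (P⇔Q p′) Qπ′ ,
       nth-insert k v _ (subst (k ≤_) (sym (trans (length-map _ π′) (proj₂ (proj₂ p′)))) k≤n))
    where p′ = ∈-Sym⁻ {n} π′∈

-- The toppling passes as a sorting network

-- Entries are indexed from 0, so index i stands for site suc i.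
AllIx : (ℕ → ℕ → Set) → List ℕ → Set
AllIx R []       = ⊤
AllIx R (x ∷ xs) = R 0 x × AllIx (R ∘ suc) xs

allIx? : {R : ℕ → ℕ → Set} → (∀ i x → Dec (R i x)) → ∀ xs → Dec (AllIx R xs)
allIx? R? []       = yes tt
allIx? R? (x ∷ xs) = R? 0 x ×-dec allIx? (R? ∘ suc) xs

AllIx-map : ∀ {P : Pred ℕ 0ℓ} {R S : ℕ → ℕ → Set} {xs} → All P xs →
  (∀ i {x} → i < length xs → P x → R i x → S i x) → AllIx R xs → AllIx S xs
AllIx-map []        f _        = tt
AllIx-map (px ∷ ps) f (r , rs) = f 0 z<s px r , AllIx-map ps (λ i i< → f (suc i) (s≤s i<)) rs

AllIx-⇒ : ∀ {R S : ℕ → ℕ → Set} → (∀ i x → R i x → S i x) → ∀ {xs} → AllIx R xs → AllIx S xs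
AllIx-⇒ f {[]}     _        = tt
AllIx-⇒ f {x ∷ xs} (r , rs) = f 0 x r , AllIx-⇒ (f ∘ suc) rs

AllIx-cong : ∀ {P : Pred ℕ 0ℓ} {R S : ℕ → ℕ → Set} {xs} → All P xs →
  (∀ i {x} → i < length xs → P x → R i x ⇔ S i x) → AllIx R xs ⇔ AllIx S xs
AllIx-cong ps f = mk⇔ (AllIx-map ps λ i i< p → Equivalence.to (f i i< p))
                      (AllIx-map ps λ i i< p → Equivalence.from (f i i< p))

AllIx-++⁺ : ∀ {R} xs {ys} → AllIx R xs → AllIx (R ∘ (length xs +_)) ys → AllIx R (xs ++ ys)
AllIx-++⁺ []       _        ss = ss
AllIx-++⁺ (x ∷ xs) (r , rs) ss = r , AllIx-++⁺ xs rs ss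

AllIx-++⁻ : ∀ {R} xs {ys} → AllIx R (xs ++ ys) → AllIx R xs × AllIx (R ∘ (length xs +_)) ys
AllIx-++⁻ []       ss       = tt , ss
AllIx-++⁻ (x ∷ xs) (r , rs) = map₁ (r ,_) (AllIx-++⁻ xs rs)

AllIx-map⁺ : ∀ {R} f xs → AllIx (λ i x → R i (f x)) xs ⇔ AllIx R (map f xs)
AllIx-map⁺ f []       = mk⇔ _ _
AllIx-map⁺ f (x ∷ xs) = mk⇔ (map₂ (Equivalence.to ih)) (map₂ (Equivalence.from ih))
  where ih = AllIx-map⁺ f xs

relabel-suc : ∀ k i → relabel (suc k) (suc i) ≡ suc (relabel k i)
relabel-suc k i with i <ᵇ k
... | true  = refl
... | false = refl

-- Insertion at `k` sends an old index `i` to `relabel k i`: indices shift by the same function as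
-- values.
AllIx-insert : ∀ {R} k v xs → k ≤ length xs →
  AllIx R (insert k v xs) ⇔ (R k v × AllIx (R ∘ relabel k) xs)
AllIx-insert zero    v xs       _         = ⇔-id _
AllIx-insert {R} (suc k) v (x ∷ xs) (s≤s k≤l) =
  mk⇔ (λ (r , rs) → let s , ss = Equivalence.to ih rs in
         s , r , AllIx-⇒ (λ i x → subst (λ j → R j x) (sym (relabel-suc k i))) ss)
      (λ (s , r , ss) → r , Equivalence.from ih
         (s , AllIx-⇒ (λ i x → subst (λ j → R j x) (relabel-suc k i)) ss))
  where ih = AllIx-insert k v xs k≤l

-- One pass of topplings through the sites holding L, read from right to
-- left, of an extra chip u: the larger chip stays behind, the smaller
-- one moves on.
pass : List ℕ → ℕ → List ℕ × ℕ
pass []      u = [] , u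
pass (c ∷ L) u = let L′ , o = pass L (u ⊓ c) in u ⊔ c ∷ L′ , o

-- In use, `us` is the extra chip followed by the chips to the right of site `p`, and `L` lists
-- sites `p` down to 1. The result is the chips emitted on the left, in order, and the chips that
-- stay.
run : List ℕ → List ℕ → List ℕ × List ℕ
run []       L = [] , L
run (u ∷ us) L = let L′ , o = pass L u ; os , L″ = run us L′ in o ∷ os , L″

⊓⊔-↭ : ∀ u c xs → u ⊓ c ∷ u ⊔ c ∷ xs ↭ u ∷ c ∷ xs
⊓⊔-↭ u c xs with ≤-total u c
... | inj₁ u≤c = ↭-reflexive (cong₂ (λ a b → a ∷ b ∷ xs) (m≤n⇒m⊓n≡m u≤c) (m≤n⇒m⊔n≡n u≤c))
... | inj₂ c≤u = ↭-trans
  (↭-reflexive (cong₂ (λ a b → a ∷ b ∷ xs) (m≥n⇒m⊓n≡n c≤u) (m≥n⇒m⊔n≡m c≤u))) (swap c u ↭-refl)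

pass-↭ : ∀ L u → let L′ , o = pass L u in o ∷ L′ ↭ u ∷ L
pass-↭ []      u = ↭-refl
pass-↭ (c ∷ L) u = ↭-trans (swap _ _ ↭-refl)
  (↭-trans (prep (u ⊔ c) (pass-↭ L (u ⊓ c)))
  (↭-trans (swap _ _ ↭-refl) (⊓⊔-↭ u c L)))

pass-length : ∀ L u → length (proj₁ (pass L u)) ≡ length L
pass-length L u = suc-injective (↭-length (pass-↭ L u))

pass-≤ : ∀ L u → proj₂ (pass L u) ≤ u
pass-≤ []      u = ≤-refl
pass-≤ (c ∷ L) u = ≤-trans (pass-≤ L (u ⊓ c)) (m⊓n≤m u c)

pass-min : ∀ L u → All (proj₂ (pass L u) ≤_) L
pass-min []      u = []
pass-min (c ∷ L) u = ≤-trans (pass-≤ L (u ⊓ c)) (m⊓n≤n u c) ∷ pass-min L (u ⊓ c)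

-- The head of `L` stands on site `suc (length L′)`, where `L′` is the tail, so this is
-- `w_j ≤ j + h` for lists read from right to left.
Bounded : ℕ → List ℕ → Set
Bounded h []      = ⊤
Bounded h (c ∷ L) = c ≤ suc (length L + h) × Bounded h L

Bounded-≤ : ∀ {h} L → Bounded h L → All (_≤ length L + h) L
Bounded-≤ []      _        = []
Bounded-≤ (c ∷ L) (c≤ , b) = c≤ ∷ All.map m≤n⇒m≤1+n (Bounded-≤ L b)

-- The bound on the carried chip drops by one at each site. As `u` and `c` differ, the smaller lies
-- strictly below the larger, which obeys the previous bound; this pays for the drop.
pass-Bounded : ∀ {h} L u → u ≤ length L + h → Unique (u ∷ L) → Bounded h L →
               Bounded h (proj₁ (pass L u))
pass-Bounded [] u _ _ _ = tt
pass-Bounded {h} (c ∷ L) u u≤ ((u≢c ∷ u∉) ∷ c∉ ∷ uL) (c≤ , b) =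
  subst (λ l → u ⊔ c ≤ suc (l + h)) (sym (pass-length L (u ⊓ c))) (⊔-lub u≤ c≤) ,
  pass-Bounded L (u ⊓ c) ⊓≤ (⊓∉ ∷ uL) b
  where
  ⊓≤ : u ⊓ c ≤ length L + h
  ⊓≤ with <-cmp u c
  ... | tri< u<c _ _ = s≤s⁻¹ (≤-trans (s≤s (m⊓n≤m u c)) (≤-trans u<c c≤))
  ... | tri≈ _ u≡c _ = contradiction u≡c u≢c
  ... | tri> _ _ c<u = s≤s⁻¹ (≤-trans (s≤s (m⊓n≤n u c)) (≤-trans c<u u≤))
  ⊓∉ : All (u ⊓ c ≢_) L
  ⊓∉ with ⊓-sel u c
  ... | inj₁ e = subst (λ m → All (m ≢_) L) (sym e) u∉
  ... | inj₂ e = subst (λ m → All (m ≢_) L) (sym e) c∉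

-- A pass replaces `c` by `u ⊔ c`, so it never lowers the chip of a site.
pass-Bounded⁻ : ∀ {h} L u → Bounded h (proj₁ (pass L u)) → Bounded h L
pass-Bounded⁻ [] u _ = tt
pass-Bounded⁻ {h} (c ∷ L) u (m≤ , b) =
  ≤-trans (m≤n⊔m u c) (subst (λ l → u ⊔ c ≤ suc (l + h)) (pass-length L (u ⊓ c)) m≤) ,
  pass-Bounded⁻ L (u ⊓ c) b

-- Passes read sites from right to left, permutations from left to right; this translates between
-- the two.
Bounded-reverse : ∀ {h} L → Bounded h L ⇔ AllIx (λ i x → x ≤ suc i + h) (reverse L)
Bounded-reverse [] = mk⇔ _ _
Bounded-reverse {h} (c ∷ L) = mk⇔
  (λ (c≤ , b) → subst (AllIx Rₕ) (sym (unfold-reverse c L))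
     (AllIx-++⁺ (reverse L) (Equivalence.to ih b) (subst (λ l → c ≤ suc l + h) len c≤ , tt)))
  (λ a → let a₁ , c≤ , _ = AllIx-++⁻ (reverse L) (subst (AllIx Rₕ) (unfold-reverse c L) a) in
     subst (λ l → c ≤ suc l + h) (sym len) c≤ , Equivalence.from ih a₁)
  where
  Rₕ = λ i x → x ≤ suc i + h
  ih = Bounded-reverse {h} L
  len : length L ≡ length (reverse L) + 0
  len = trans (sym (length-reverse L)) (sym (+-identityʳ _))

from-AllIx : ∀ s k → AllIx (λ i x → x ≤ i + s) (from s k)
from-AllIx s zero    = tt
from-AllIx s (suc k) = ≤-refl , AllIx-⇒ (λ i x → subst (x ≤_) (+-suc i s)) (from-AllIx (suc s) k)

-- In the sorted block site `j` holds exactly `j + h`, so the bound holds with equality.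
reverse-from-Bounded : ∀ h L k → reverse L ≡ from (suc h) k → Bounded h L
reverse-from-Bounded h L k eq = Equivalence.from (Bounded-reverse L) (subst (AllIx _) (sym eq)
  (AllIx-⇒ (λ i x → subst (x ≤_) (+-suc i h)) (from-AllIx (suc h) k)))

-- The largest value exceeds the bound at every site except the rightmost, so it is the head of `L`.
-- Induction sorts the rest.
Bounded-sorted : ∀ h L → Bounded h L → L ↭ from (suc h) (length L) →
                 reverse L ≡ from (suc h) (length L)
Bounded-sorted h [] _ _ = refl
Bounded-sorted h (c ∷ L) (c≤ , b) p = begin
  reverse (c ∷ L)               ≡⟨ unfold-reverse c L ⟩
  reverse L ++ c ∷ []           ≡⟨ cong₂ (λ xs x → xs ++ x ∷ []) (Bounded-sorted h L b p′) c≡top ⟩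
  from (suc h) l ++ top ∷ []    ≡⟨ from-∷ʳ (suc h) l ⟨
  from (suc h) (suc l)          ∎
  where
  open ≡-Reasoning
  l   = length L
  top = suc h + l
  c∷L↭ : c ∷ L ↭ top ∷ from (suc h) l
  c∷L↭ = ↭-trans p (↭-trans (↭-reflexive (from-∷ʳ (suc h) l)) (↭-sym (∷↭∷ʳ top (from (suc h) l))))
  c≡top : c ≡ top
  c≡top with ∈-resp-↭ (↭-sym c∷L↭) (here refl)
  ... | here top≡c  = sym top≡c
  ... | there top∈L = contradiction (All.lookup (Bounded-≤ L b) top∈L)
                        (<⇒≱ (s≤s (≤-reflexive (+-comm l h))))
  p′ : L ↭ from (suc h) l
  p′ = drop-∷ (subst (λ x → x ∷ L ↭ top ∷ from (suc h) l) c≡top c∷L↭)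

-- Think of `t` as the number of passes already made: the chips left are `t + 1`, `t + 2` and so on.
-- Every later entrant exceeds `t + 1`, so `t + 1` is `u` or lies in `L`, and the pass, which emits
-- a minimum, emits it. The hypotheses then hold again for `suc t`.
run-sorts : ∀ h t us L → h ≡ t + length us → us ++ L ↭ from (suc t) (length us + length L) →
  AllIx (λ i x → suc i + t ≤ x) us → Bounded h L →
  let os , L′ = run us L in os ++ reverse L′ ≡ from (suc t) (length us + length L)
run-sorts h t [] L refl p _ b rewrite +-identityʳ t = Bounded-sorted t L b p
run-sorts h t (u ∷ us) L h≡ p (u≥ , us≥) b =
  cong₂ _∷_ o≡ (subst
    (λ l → proj₁ rest ++ reverse (proj₂ rest) ≡ from (suc (suc t)) (length us + l))
    (pass-length L u)
    (run-sorts h (suc t) us L′ (trans h≡ (+-suc t _)) p′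
      (AllIx-⇒ (λ i x → subst (_≤ x) (cong suc (sym (+-suc i t)))) us≥)
      (pass-Bounded L u u≤ uniq b)))
  where
  n = length us + length L
  L′ = proj₁ (pass L u)
  o = proj₂ (pass L u)
  rest = run us L′
  range-p : ∀ {x} → x ∈ u ∷ us ++ L → suc t ≤ x × x < suc t + suc n
  range-p x∈ = ∈-from⁻ _ (∈-resp-↭ p x∈)
  u∷us++L↭ : u ∷ us ++ L ↭ o ∷ us ++ L′
  u∷us++L↭ = ↭-trans (↭-sym (shift u us L)) (↭-trans (++⁺ˡ us (↭-sym (pass-↭ L u))) (shift o us L′))
  -- The offset `i` is generalised for the induction and starts at 0.
  us> : ∀ {xs i} → AllIx (λ j x → suc (suc (i + j)) + t ≤ x) xs → All (suc t <_) xs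
  us> {[]} _ = []
  us> {x ∷ xs} {i} (x≥ , xs≥) = ≤-trans (s≤s (s≤s (m≤n+m t (i + 0)))) x≥ ∷
    us> {xs} {suc i} (AllIx-⇒ (λ j x → subst (λ m → suc (suc m) + t ≤ x) (+-suc i j)) xs≥)
  o≤ : o ≤ suc t
  o≤ with ∈-resp-↭ (↭-sym p) (here refl)
  ... | here refl = pass-≤ L u
  ... | there t∈ with ∈-++⁻ us t∈
  ...   | inj₁ t∈us = contradiction (All.lookup (us> {i = 0} us≥) t∈us) (<-irrefl refl)
  ...   | inj₂ t∈L  = All.lookup (pass-min L u) t∈L
  o≡ : o ≡ suc t
  o≡ = ≤-antisym o≤ (proj₁ (range-p (∈-resp-↭ (↭-sym u∷us++L↭) (here refl))))
  p′ : us ++ L′ ↭ from (suc (suc t)) (length us + length L′)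
  p′ = subst (λ l → us ++ L′ ↭ from (suc (suc t)) (length us + l)) (sym (pass-length L u))
         (drop-∷ (subst (λ x → x ∷ us ++ L′ ↭ _) o≡ (↭-trans (↭-sym u∷us++L↭) p)))
  -- No chip exceeds `t + suc (length us) + length L`, and `h = t + suc (length us)`.
  u≤ : u ≤ length L + h
  u≤ = s≤s⁻¹ (subst (u <_) eq (proj₂ (range-p (here refl))))
    where
    open ≡-Reasoning
    l = length us
    m = length L
    eq : suc t + suc (l + m) ≡ suc (m + h)
    eq = cong suc (begin
      t + (suc l + m) ≡⟨ +-assoc t (suc l) m ⟨
      t + suc l + m   ≡⟨ +-comm _ m ⟩
      m + (t + suc l) ≡⟨ cong (m +_) h≡ ⟨
      m + h           ∎)
  uniq : Unique (u ∷ L)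
  uniq = Unique-∷++⁻ us (Unique-resp-↭ (↭-sym p) (from-unique _ _))
    where
    Unique-++⁻ : ∀ (xs : List ℕ) {ys} → Unique (xs ++ ys) → Unique ys
    Unique-++⁻ []       q       = q
    Unique-++⁻ (x ∷ xs) (_ ∷ q) = Unique-++⁻ xs q
    Unique-∷++⁻ : ∀ {x : ℕ} xs {ys} → Unique (x ∷ xs ++ ys) → Unique (x ∷ ys)
    Unique-∷++⁻ xs (x∉ ∷ q) = All.++⁻ʳ xs x∉ ∷ Unique-++⁻ xs q

run-Bounded⁻ : ∀ {h} us L → Bounded h (proj₂ (run us L)) → Bounded h L
run-Bounded⁻ []       L b = b
run-Bounded⁻ (u ∷ us) L b = pass-Bounded⁻ L u (run-Bounded⁻ us _ b)

-- A pass emits at most the chip that entered it, so the prescribed outputs bound the entrants from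
-- below.
run-outs≡⁻ : ∀ t us L {zs} k → proj₁ (run us L) ++ zs ≡ from (suc t) (length us + k) →
  AllIx (λ i x → suc i + t ≤ x) us × zs ≡ from (suc (length us + t)) k
run-outs≡⁻ t []       L k eq = tt , eq
run-outs≡⁻ t (u ∷ us) L k eq with ∷-injective eq
... | o≡ , eq′ with run-outs≡⁻ (suc t) us _ k eq′
... | us≥ , zs≡ =
  (subst (_≤ u) o≡ (pass-≤ L u) ,
   AllIx-⇒ (λ i x → subst (_≤ x) (cong suc (+-suc i t))) us≥) ,
  trans zs≡ (cong (λ m → from (suc m) k) (+-suc (length us) t))

-- For necessity, the emitted chips bound `us` from below, and the sorted remainder meets the upper
-- bounds, which pull back through the passes because these only raise the chips that stay.
run-sorts⇔ : ∀ us L → us ++ L ↭ from 1 (length us + length L) →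
  let os , L′ = run us L in
  os ++ reverse L′ ≡ from 1 (length us + length L) ⇔
  (AllIx (λ i x → suc i ≤ x) us × Bounded (length us) L)
run-sorts⇔ us L p = mk⇔
  (λ eq → let us≥ , L≡ = run-outs≡⁻ 0 us L (length L) eq in
    AllIx-⇒ (λ i x → subst (_≤ x) (cong suc (+-identityʳ i))) us≥ ,
    run-Bounded⁻ us L (reverse-from-Bounded _ _ (length L)
      (trans L≡ (cong (λ m → from (suc m) (length L)) (+-identityʳ (length us))))))
  (λ (us≥ , b) → run-sorts (length us) 0 us L refl p
    (AllIx-⇒ (λ i x → subst (_≤ x) (cong suc (sym (+-identityʳ i)))) us≥) b)

-- Leftmost toppling

sing : List ℕ → Config
sing = map (_∷ [])

sing-stable : ∀ xs → Stable (sing xs)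
sing-stable xs = All.map⁺ (All.universal (λ _ → s≤s z≤n) xs)

fireAt-skip : ∀ l s {rest s′ rest′} → length s ≤ 1 →
  fireAt s rest ≡ just (s′ , rest′) → fireAt l (s ∷ rest) ≡ just (l , s′ ∷ rest′)
fireAt-skip l []          _ eq rewrite eq = refl
fireAt-skip l (_ ∷ [])    _ eq rewrite eq = refl
fireAt-skip l (_ ∷ _ ∷ _) (s≤s ()) _

fire-skip : ∀ s {rest s′ rest′} → length s ≤ 1 →
  fireAt s rest ≡ just (s′ , rest′) → fire (s ∷ rest) ≡ just (s′ ∷ rest′)
fire-skip []          _ eq rewrite eq = refl
fire-skip (_ ∷ [])    _ eq rewrite eq = refl
fire-skip (_ ∷ _ ∷ _) (s≤s ()) _

-- Stable sites are skipped, each in turn becoming the left neighbour that `fireAt` carries.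
fireAt-leftmost : ∀ l₀ {pre} l {a b s rest} → Stable pre → length l ≤ 1 →
  fireAt l₀ (pre ++ l ∷ (a ∷ b ∷ s) ∷ rest) ≡ just (l₀ , pre ++ ins a l ∷ s ∷ addHead b rest)
fireAt-leftmost l₀         l []         l≤1 = fireAt-skip l₀ l l≤1 refl
fireAt-leftmost l₀ {q ∷ _} l (q≤1 ∷ st) l≤1 = fireAt-skip l₀ q q≤1 (fireAt-leftmost q l st l≤1)

fire-leftmost : ∀ {pre} l {a b s rest} → Stable pre → length l ≤ 1 →
  fire (pre ++ l ∷ (a ∷ b ∷ s) ∷ rest) ≡ just (pre ++ ins a l ∷ s ∷ addHead b rest)
fire-leftmost         l []         l≤1 = fire-skip l l≤1 refl
fire-leftmost {q ∷ _} l (q≤1 ∷ st) l≤1 = fire-skip q q≤1 (fireAt-leftmost q l st l≤1)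

fireAt-stable : ∀ {l c} → Stable c → fireAt l c ≡ nothing
fireAt-stable [] = refl
fireAt-stable {c = [] ∷ c} (_ ∷ st) rewrite fireAt-stable {[]} st = refl
fireAt-stable {c = (x ∷ []) ∷ c} (_ ∷ st) rewrite fireAt-stable {x ∷ []} st = refl
fireAt-stable {c = (_ ∷ _ ∷ _) ∷ _} (s≤s () ∷ _)

fire-stable : ∀ {c} → Stable c → fire c ≡ nothing
fire-stable [] = refl
fire-stable {[] ∷ c} (_ ∷ st) rewrite fireAt-stable {[]} st = refl
fire-stable {(x ∷ []) ∷ c} (_ ∷ st) rewrite fireAt-stable {x ∷ []} st = refl
fire-stable {(_ ∷ _ ∷ _) ∷ _} (s≤s () ∷ _)

stabilize-stable : ∀ k {c} → Stable c → stabilize k c ≡ c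
stabilize-stable zero    _  = refl
stabilize-stable (suc k) st rewrite fire-stable st = refl

infix 4 _⟶⟨_⟩_
-- Reduction at a cost of `m` units of fuel, expressed through `stabilize` for every remainder `k`,
-- so that costs add under composition.
record _⟶⟨_⟩_ (c : Config) (m : ℕ) (c′ : Config) : Set where
  constructor steps
  field stabilize-+ : ∀ k → stabilize (m + k) c ≡ stabilize k c′

open _⟶⟨_⟩_

fire⇒⟶ : ∀ {c c′} → fire c ≡ just c′ → c ⟶⟨ 1 ⟩ c′
fire⇒⟶ {c} {c′} eq = steps go
  where
  go : ∀ k → stabilize (1 + k) c ≡ stabilize k c′
  go k rewrite eq = refl

⟶-steps : ∀ {c c′ m n} → m ≡ n → c ⟶⟨ m ⟩ c′ → c ⟶⟨ n ⟩ c′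
⟶-steps refl s = s

⟶-trans : ∀ {c c′ c″ m n} → c ⟶⟨ m ⟩ c′ → c′ ⟶⟨ n ⟩ c″ → c ⟶⟨ m + n ⟩ c″
⟶-trans {c} {m = m} {n} (steps s) (steps s′) = steps λ k →
  trans (cong (λ l → stabilize l c) (+-assoc m n k)) (trans (s (n + k)) (s′ k))

ins-singleton : ∀ u c → ins u (c ∷ []) ≡ u ⊓ c ∷ u ⊔ c ∷ []
ins-singleton u c with u ≤ᵇ c in eq
... | true  = let u≤c = ≤ᵇ⇒≤ u c (subst T (sym eq) tt) in
  sym (cong₂ (λ a b → a ∷ b ∷ []) (m≤n⇒m⊓n≡m u≤c) (m≤n⇒m⊔n≡n u≤c))
... | false = let c≤u = ≰⇒≥ (λ u≤c → subst T eq (≤⇒≤ᵇ u≤c)) in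
  sym (cong₂ (λ a b → a ∷ b ∷ []) (m≥n⇒m⊓n≡n c≤u) (m≥n⇒m⊔n≡m c≤u))

-- The sites to the left are kept in reverse, as in a zipper: a pass moves leftwards and finds the
-- next site at the head.
topple : ∀ {pre l u c X ys} → Stable pre → length l ≤ 1 →
  pre ʳ++ l ∷ ins u (c ∷ []) ∷ X ∷ ys ⟶⟨ 1 ⟩ pre ʳ++ ins (u ⊓ c) l ∷ [] ∷ ins (u ⊔ c) X ∷ ys
topple {pre} {l} {u} {c} {X} {ys} st l≤1 = fire⇒⟶ (begin
  fire (pre ʳ++ l ∷ ins u (c ∷ []) ∷ X ∷ ys)
    ≡⟨ cong (λ s → fire (pre ʳ++ l ∷ s ∷ X ∷ ys)) (ins-singleton u c) ⟩
  fire (pre ʳ++ l ∷ (u ⊓ c ∷ u ⊔ c ∷ []) ∷ X ∷ ys)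
    ≡⟨ cong fire (ʳ++-defn pre) ⟩
  fire (reverse pre ++ l ∷ (u ⊓ c ∷ u ⊔ c ∷ []) ∷ X ∷ ys)
    ≡⟨ fire-leftmost l (All-resp-↭ (↭-sym (↭-reverse pre)) st) l≤1 ⟩
  just (reverse pre ++ ins (u ⊓ c) l ∷ [] ∷ ins (u ⊔ c) X ∷ ys)
    ≡⟨ cong just (ʳ++-defn pre) ⟨
  just (pre ʳ++ ins (u ⊓ c) l ∷ [] ∷ ins (u ⊔ c) X ∷ ys) ∎)
  where open ≡-Reasoning

-- The block of single chips ends up one site further right, with `o` and an empty site before it,
-- while `u ⊔ c` lands on `X`. The empty site is where the next pass emits its chip.
topple-pass : ∀ {pre} u c L X ys → Stable pre →
  let L′ , o = pass L (u ⊓ c) in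
  pre ʳ++ [] ∷ (sing L ʳ++ ins u (c ∷ []) ∷ X ∷ ys)
    ⟶⟨ suc (length L) ⟩
  pre ʳ++ (o ∷ []) ∷ [] ∷ (sing L′ ʳ++ ins (u ⊔ c) X ∷ ys)
topple-pass {pre} u c [] X ys st = topple {pre} st z≤n
topple-pass {pre} u c (d ∷ L) X ys st = ⟶-trans
  (subst₂ (λ C C′ → C ⟶⟨ 1 ⟩ C′) (++-ʳ++ (sing L)) (++-ʳ++ (sing L))
    (topple {sing L ++ [] ∷ pre} {d ∷ []} (All.++⁺ (sing-stable L) (z≤n ∷ st)) (s≤s z≤n)))
  -- The site just emptied takes the place of `X`.
  (topple-pass (u ⊓ c) d L [] (ins (u ⊔ c) X ∷ ys) st)

-- At the end of a pass `u ⊔ c` shares a site with the next chip `v`. The next pass treats `v` as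
-- the extra chip and `u ⊔ c` as the head of the sites, while `o` joins the stable prefix. After the
-- last pass `u ⊔ c` settles on the empty right end.
topple-run : ∀ {pre} u us c L → Stable pre →
  let os , L′ = run (u ∷ us) (c ∷ L) in
  pre ʳ++ [] ∷ (sing L ʳ++ ins u (c ∷ []) ∷ sing us ++ [] ∷ [])
    ⟶⟨ suc (length us) * suc (length L) ⟩
  pre ʳ++ (sing os ++ [] ∷ (sing L′ ʳ++ []))
topple-run {pre} u [] c L st = ⟶-steps (sym (*-identityˡ (suc (length L))))
  (topple-pass {pre} u c L [] [] st)
topple-run {pre} u (v ∷ us) c L st =
  ⟶-trans {m = suc (length L)} {suc (length us) * suc (length L)}
    (topple-pass {pre} u c L (v ∷ []) (sing us ++ [] ∷ []) st)
    (subst₂ (λ s l → pre ʳ++ (o ∷ []) ∷ [] ∷ (sing L′ ʳ++ s ∷ sing us ++ [] ∷ [])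
                       ⟶⟨ suc (length us) * suc l ⟩
                     pre ʳ++ (o ∷ []) ∷ (sing (proj₁ next) ++ [] ∷ (sing (proj₂ next) ʳ++ [])))
      -- A doubled site is a sorted pair, so the two chips may exchange the roles of arrival and
      -- resident.
      (trans (ins-singleton v (u ⊔ c)) (trans
        (cong₂ (λ a b → a ∷ b ∷ []) (⊓-comm v (u ⊔ c)) (⊔-comm v (u ⊔ c)))
        (sym (ins-singleton (u ⊔ c) v))))
      (pass-length L (u ⊓ c))
      (topple-run {(o ∷ []) ∷ pre} v us (u ⊔ c) L′ (s≤s z≤n ∷ st)))
  where
  L′ = proj₁ (pass L (u ⊓ c))
  o = proj₂ (pass L (u ⊓ c))
  next = run (v ∷ us) (u ⊔ c ∷ L′)

-- The initial configuration and its stabilisation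

inner-right : ∀ r {p i} xs → p < i → inner r p i xs ≡ sing (map (relabel r) xs)
inner-right r []       p<i = refl
inner-right r {p} {i} (x ∷ xs) p<i with i ≡ᵇ p in eq
... | true  = contradiction (sym (≡ᵇ⇒≡ i p (subst T (sym eq) tt))) (<⇒≢ p<i)
... | false = cong (_ ∷_) (inner-right r xs (m≤n⇒m≤1+n p<i))

inner-split : ∀ r {p i} xs c ys → i + length xs ≡ p →
  inner r p i (xs ++ c ∷ ys) ≡
  sing (map (relabel r) xs) ++ ins r (relabel r c ∷ []) ∷ sing (map (relabel r) ys)
inner-split r {i = i} [] c ys refl rewrite +-identityʳ i with i ≡ᵇ i in eq
... | true  = cong (_ ∷_) (inner-right r ys ≤-refl)
... | false = contradiction (≡⇒≡ᵇ i i refl) (λ t → subst T eq t)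
inner-split r {p} {i} (x ∷ xs) c ys e with i ≡ᵇ p in eq
... | true  = contradiction (trans (≡ᵇ⇒≡ i p (subst T (sym eq) tt)) (sym e)) (<⇒≢ (m<m+n i z<s))
... | false = cong (_ ∷_) (inner-split r xs c ys (trans (sym (+-suc i (length xs))) e))

initial-split : ∀ r xs c ys → initial r (suc (length xs)) (xs ++ c ∷ ys) ≡
  [] ∷ (sing (reverse (map (relabel r) xs)) ʳ++
    ins r (relabel r c ∷ []) ∷ sing (map (relabel r) ys) ++ [] ∷ [])
initial-split r xs c ys = cong ([] ∷_) (begin
  inner r (suc (length xs)) 1 (xs ++ c ∷ ys) ++ [] ∷ []
    ≡⟨ cong (_++ [] ∷ []) (inner-split r xs c ys refl) ⟩
  (sing ws ++ tail₁) ++ [] ∷ []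
    ≡⟨ ++-assoc (sing ws) tail₁ _ ⟩
  sing ws ++ tail₁ ++ [] ∷ []
    ≡⟨ cong (_++ tail₁ ++ [] ∷ [])
         (trans (sym (reverse-map _ (reverse ws))) (cong sing (reverse-involutive ws))) ⟨
  reverse (sing (reverse ws)) ++ tail₁ ++ [] ∷ []
    ≡⟨ ʳ++-defn (sing (reverse ws)) ⟨
  sing (reverse ws) ʳ++ tail₁ ++ [] ∷ [] ∎)
  where
  open ≡-Reasoning
  ws = map (relabel r) xs
  tail₁ = ins r (relabel r c ∷ []) ∷ sing (map (relabel r) ys)

-- A run makes one toppling per pass and site. Two of the three factors `n + 2` of the fuel absorb
-- the two counts, and the third is at least 1.
fuel-enough : ∀ {n p h} → p ≤ suc n → h ≤ suc n → p * h ≤ fuel n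
fuel-enough {n} {p} {h} p≤ h≤ = *-mono-≤ (≤-trans p≤ n<)
  (subst (_≤ (n + 2) * ((n + 2) * 1)) (*-identityʳ h)
  (*-mono-≤ (≤-trans h≤ n<) (subst (1 ≤_) (sym (*-identityʳ (n + 2))) (≤-trans (s≤s z≤n) n<))))
  where
  n< : suc n ≤ n + 2
  n< = subst (suc n ≤_) (+-comm 2 n) (n≤1+n (suc n))

stabilize-run : ∀ n u us c L → length (u ∷ us) ≤ suc n → length (c ∷ L) ≤ suc n →
  let os , L′ = run (u ∷ us) (c ∷ L)
      f = stabilize (fuel n) ([] ∷ (sing L ʳ++ ins u (c ∷ []) ∷ sing us ++ [] ∷ [])) in
  Stable f × concat f ≡ os ++ reverse L′
stabilize-run n u us c L h≤ p≤ =
  subst (λ f → Stable f × concat f ≡ os ++ reverse L′) (sym eq) (st , concat≡)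
  where
  open ≡-Reasoning
  os = proj₁ (run (u ∷ us) (c ∷ L))
  L′ = proj₂ (run (u ∷ us) (c ∷ L))
  end = sing os ++ [] ∷ (sing L′ ʳ++ [])
  st : Stable end
  st = All.++⁺ (sing-stable os) (z≤n ∷ All-resp-↭ (↭-sym (↭-reverse (sing L′))) (sing-stable L′))
  m = suc (length us) * suc (length L)
  start = [] ∷ (sing L ʳ++ ins u (c ∷ []) ∷ sing us ++ [] ∷ [])
  eq : stabilize (fuel n) start ≡ end
  eq = begin
    stabilize (fuel n) start
      ≡⟨ cong (λ k → stabilize k start) (m+[n∸m]≡n (fuel-enough h≤ p≤)) ⟨
    stabilize (m + (fuel n ∸ m)) start
      ≡⟨ stabilize-+ (topple-run {[]} u us c L []) (fuel n ∸ m) ⟩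
    stabilize (fuel n ∸ m) end
      ≡⟨ stabilize-stable (fuel n ∸ m) st ⟩
    end ∎
  concat≡ : concat end ≡ os ++ reverse L′
  concat≡ = begin
    concat end
      ≡⟨ concat-++ (sing os) ([] ∷ reverse (sing L′)) ⟨
    concat (sing os) ++ concat (reverse (sing L′))
      ≡⟨ cong (λ z → concat (sing os) ++ concat z) (reverse-map _ L′) ⟨
    concat (sing os) ++ concat (sing (reverse L′))
      ≡⟨ cong₂ _++_ (concat-map-[_] os) (concat-map-[_] (reverse L′)) ⟩
    os ++ reverse L′ ∎

-- Sorted outcomes as a window condition on every site

-- Site j = suc i may hold the relabelled chips w with -p < w - j ≤ h.
Fits : (p h r : ℕ) → ℕ → ℕ → Set
Fits p h r i x = relabel r x ≤ suc i + h × suc i < relabel r x + p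

Good : (p h r : ℕ) → List ℕ → Set
Good p h r = AllIx (Fits p h r)

good? : ∀ p h r → Decidable (Good p h r)
good? p h r = allIx? λ i x → (relabel r x ≤? suc i + h) ×-dec (suc i <? relabel r x + p)

-- On the first `p` sites the lower bound follows from `1 ≤ w`; beyond them the upper bound follows
-- from `w ≤ p + h`. Two one-sided conditions thus merge into one uniform condition.
window⇔ : ∀ {h} ws vs → let p = length ws in All (InRange (p + h)) (ws ++ vs) →
  (AllIx (λ i x → suc (suc i) ≤ x) vs × AllIx (λ i x → x ≤ suc i + h) ws) ⇔
  AllIx (λ i w → w ≤ suc i + h × suc i < w + p) (ws ++ vs)
window⇔ {h} ws vs a = mk⇔
  (λ (as , bs) → AllIx-++⁺ ws
    (AllIx-map (All.++⁻ˡ ws a) (λ i i<p (1≤w , _) w≤ → w≤ , +-mono-≤ 1≤w i<p) bs)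
    (AllIx-map (All.++⁻ʳ ws a) (λ i {w} _ (_ , w≤) i<w →
       ≤-trans w≤ (+-monoˡ-≤ h (m≤n⇒m≤1+n (m≤m+n p i))) ,
       subst (λ j → suc (suc j) ≤ w + p) (+-comm i p) (+-monoˡ-≤ p i<w)) as))
  (λ g → let gw , gv = AllIx-++⁻ ws g in
    AllIx-⇒ (λ i x (_ , i<) → +-cancelʳ-≤ p _ x
      (subst (λ j → suc (suc j) ≤ x + p) (+-comm p i) i<)) gv ,
    AllIx-⇒ (λ _ _ → proj₁) gw)
  where p = length ws

split-at : ∀ q (π : List A) → q < length π →
           ∃ λ xs → ∃ λ c → ∃ λ ys → π ≡ xs ++ c ∷ ys × length xs ≡ q
split-at zero    (x ∷ π) _         = [] , x , π , refl , refl
split-at (suc q) (x ∷ π) (s≤s q<) with split-at q π q<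
... | xs , c , ys , refl , refl = x ∷ xs , c , ys , refl , refl

-- The run always ends in a stable configuration, so only sortedness is at stake; `run-sorts⇔` and
-- `window⇔` turn it into inequalities.
InT⇔Good : ∀ {n p h r π} → suc n ≡ p + h → 1 ≤ p → 1 ≤ h → InRange (suc n) r → Perm n π →
           InT n r p π ⇔ Good p h r π
InT⇔Good {n} {suc q} {suc h₀} {r} {π} n≡ _ _ r∈@(1≤r , _) P@(_ , _ , len)
  with split-at q π (subst (q <_) (sym len) (subst (q <_) (sym (suc-injective n≡)) (m<m+n q z<s)))
... | xs , c , ys , refl , refl = mk⇔
  (λ (_ , eq) → Equivalence.to good⇔ (Equivalence.to sorts (trans (sym concat≡) (trans eq range≡))))
  (λ g → stable , trans concat≡
    (trans (Equivalence.from sorts (Equivalence.from good⇔ g)) (sym range≡)))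
  where
  open ≡-Reasoning
  h = suc h₀
  w = map (relabel r)
  us = r ∷ w ys
  L = relabel r c ∷ reverse (w xs)
  ws = w xs ++ relabel r c ∷ []
  ws-vs : ws ++ w ys ≡ w π
  ws-vs = trans (++-assoc (w xs) _ (w ys)) (sym (map-++ (relabel r) xs (c ∷ ys)))
  rev-L : reverse L ≡ ws
  rev-L = trans (unfold-reverse (relabel r c) (reverse (w xs)))
    (cong (_++ relabel r c ∷ []) (reverse-involutive (w xs)))
  P′ : Perm (suc n) (r ∷ w π)
  P′ = Perm-relabel r∈ P
  us++L↭ : us ++ L ↭ r ∷ w π
  us++L↭ = prep r (↭-trans (++-comm (w ys) L)
    (↭-trans (++⁺ʳ (w ys) (↭-trans (↭-sym (↭-reverse L)) (↭-reflexive rev-L)))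
    (↭-reflexive ws-vs)))
  total : length us + length L ≡ suc n
  total = trans (sym (length-++ us)) (trans (↭-length us++L↭) (proj₂ (proj₂ P′)))
  L-length : length L ≡ suc (length xs)
  L-length = cong suc (trans (length-reverse (w xs)) (length-map _ xs))
  us-length : length us ≡ h
  us-length = +-cancelʳ-≡ (length L) (length us) h (trans total (trans n≡
    (trans (+-comm (suc (length xs)) h) (cong (h +_) (sym L-length)))))
  range≡ : range 1 (suc n) ≡ from 1 (length us + length L)
  range≡ = trans (range≡from 1 (suc n)) (cong (from 1) (sym total))
  sorts = run-sorts⇔ us L
    (subst (λ m → us ++ L ↭ from 1 m) (sym total) (↭-trans us++L↭ (Perm-↭ P′)))
  Outcome : Config → Set
  Outcome C = Stable (stabilize (fuel n) C) ×
    concat (stabilize (fuel n) C) ≡ proj₁ (run us L) ++ reverse (proj₂ (run us L))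
  outcome : Outcome (initial r (suc (length xs)) π)
  outcome = subst Outcome (sym (initial-split r xs c ys))
    (stabilize-run n r (w ys) (relabel r c) (reverse (w xs))
      (subst (length us ≤_) total (m≤m+n _ _))
      (subst (length L ≤_) total (m≤n+m _ (length us))))
  stable = proj₁ outcome
  concat≡ = proj₂ outcome
  ws-length : length ws ≡ suc (length xs)
  ws-length = trans (cong length (sym rev-L)) (trans (length-reverse L) L-length)
  inRange : All (InRange (length ws + h)) (ws ++ w ys)
  inRange = subst₂ (λ m → All (InRange m)) (trans n≡ (cong (_+ h) (sym ws-length))) (sym ws-vs)
    (All.tail (proj₁ (proj₂ P′)))
  good⇔ : (AllIx (λ i x → suc i ≤ x) us × Bounded (length us) L) ⇔ Good (suc (length xs)) h r π
  good⇔ = mk⇔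
    -- The head of `us` is the extra chip, bounded only by `1 ≤ r`, so the bounds to the right of
    -- site `p` start at 2.
    (λ ((_ , us≥) , b) → Equivalence.from (AllIx-map⁺ (relabel r) π)
      (subst₂ Window ws-length ws-vs (Equivalence.to window
        (us≥ , subst (AllIx _) rev-L (Equivalence.to (Bounded-reverse L)
          (subst (λ m → Bounded m L) us-length b))))))
    (λ g → let us≥ , b = Equivalence.from window (subst₂ Window (sym ws-length) (sym ws-vs)
                 (Equivalence.to (AllIx-map⁺ (relabel r) π) g)) in
      (1≤r , us≥) , subst (λ m → Bounded m L) (sym us-length)
        (Equivalence.from (Bounded-reverse L) (subst (AllIx _) (sym rev-L) b)))
    where
    Window : ℕ → List ℕ → Set
    Window p = AllIx (λ i w → w ≤ suc i + h × suc i < w + p)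
    window = window⇔ {h} ws (w ys) inRange

-- Recurrences

-- An indexwise form, to be merged with `Fits` site by site. The hypothesis `1 ≤ v` rules out the
-- default 0 of `nth`.
nth-≢ : ∀ {k v} xs → 1 ≤ v → nth k xs ≢ v ⇔ AllIx (λ i x → ¬ (i ≡ k × x ≡ v)) xs
nth-≢ {k} {suc v} [] _ = mk⇔ _ (λ _ ())
nth-≢ {zero} {v} (x ∷ xs) _ = mk⇔
  (λ x≢v → (λ (_ , x≡v) → x≢v x≡v) , AllIx-⇒ {λ _ _ → ⊤} (λ { _ _ _ (() , _) }) (AllIx-⊤ xs))
  (λ (¬e , _) x≡v → ¬e (refl , x≡v))
  where
  AllIx-⊤ : ∀ xs → AllIx (λ _ _ → ⊤) xs
  AllIx-⊤ []       = tt
  AllIx-⊤ (x ∷ xs) = tt , AllIx-⊤ xs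
nth-≢ {suc k} {v} (x ∷ xs) 1≤v = mk⇔
  (λ ≢v → (λ { (() , _) }) ,
    AllIx-⇒ (λ _ _ ¬e (e , e′) → ¬e (suc-injective e , e′)) (Equivalence.to ih ≢v))
  (λ (_ , a) → Equivalence.from ih (AllIx-⇒ (λ _ _ ¬e (e , e′) → ¬e (cong suc e , e′)) a))
  where ih = nth-≢ {k} {v} xs 1≤v

AllIx-× : ∀ {R S} xs → (AllIx R xs × AllIx S xs) ⇔ AllIx (λ i x → R i x × S i x) xs
AllIx-× []       = mk⇔ _ _
AllIx-× (x ∷ xs) = mk⇔
  (λ ((r , rs) , (s , ss)) → (r , s) , Equivalence.to ih (rs , ss))
  (λ ((r , s) , rss) → let rs , ss = Equivalence.from ih rss in (r , rs) , (s , ss))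
  where ih = AllIx-× xs

AllIx-nth : ∀ {R k} xs → k < length xs → AllIx R xs → R k (nth k xs)
AllIx-nth {k = zero}  (x ∷ xs) _         (r , _)  = r
AllIx-nth {k = suc k} (x ∷ xs) (s≤s k<l) (_ , rs) = AllIx-nth xs k<l rs

All-nth : ∀ {P : Pred ℕ 0ℓ} {k xs} → k < length xs → All P xs → P (nth k xs)
All-nth {k = zero}  _         (p ∷ _)  = p
All-nth {k = suc k} (s≤s k<l) (_ ∷ ps) = All-nth k<l ps

goodCount : (p h r n : ℕ) → ℕ
goodCount p h r n = count (good? p h r) (Sym n)

-- The deleted chip `v` becomes the extra chip of the smaller problem: undoing the deletion and
-- making room for an extra chip `v` both apply `relabel v`.
goodCount-graft : ∀ p h r {p′ h′ k v m} → k ≤ m → InRange (suc m) v → Fits p h r k v →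
  (∀ i {y} → i < m → InRange m y → Fits p h r (relabel k i) (relabel v y) ⇔ Fits p′ h′ v i y) →
  count (λ π → good? p h r π ×-dec (nth k π ≟ v)) (Sym (suc m)) ≡ goodCount p′ h′ v m
goodCount-graft p h r {p′} {h′} {k} {v} {m} k≤m v∈ fits fits⇔ =
  count-graft (good? p h r) (good? p′ h′ v) k v k≤m v∈ λ {π} P@(_ , a , l) →
    let ins⇔ = AllIx-insert {Fits p h r} k v (map (relabel v) π)
                 (subst (k ≤_) (sym (trans (length-map _ π) l)) k≤m)
        map⇔ = AllIx-map⁺ {Fits p h r ∘ relabel k} (relabel v) π
        fit⇔ = AllIx-cong a (λ i i<l → fits⇔ i (subst (i <_) l i<l))
    in mk⇔ (Equivalence.to fit⇔ ∘ Equivalence.from map⇔ ∘ proj₂ ∘ Equivalence.to ins⇔)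
           (λ g → Equivalence.from ins⇔ (fits , Equivalence.to map⇔ (Equivalence.from fit⇔ g)))

-- Splits by whether position `k` holds `v`: the permutations that avoid this are those good for
-- `r′`, and from the others position `k` is deleted.
goodCount-step : ∀ p h r r′ {p′ h′ k v m} → k ≤ m → InRange (suc m) v →
  (∀ i {x} → i < suc m → InRange (suc m) x →
     (Fits p h r i x × ¬ (i ≡ k × x ≡ v)) ⇔ Fits p h r′ i x) →
  Fits p h r k v →
  (∀ i {y} → i < m → InRange m y → Fits p h r (relabel k i) (relabel v y) ⇔ Fits p′ h′ v i y) →
  goodCount p h r (suc m) ≡ goodCount p h r′ (suc m) + goodCount p′ h′ v m
goodCount-step p h r r′ {p′} {h′} {k} {v} {m} k≤m v∈ step⇔ fits fits⇔ = trans
  (count-split (good? p h r) (λ π → nth k π ≟ v) (Sym (suc m)))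
  (cong₂ _+_
    (count-cong _ (good? p h r′) (Sym (suc m)) λ {π} π∈ →
      let _ , a , l = ∈-Sym⁻ π∈
          ≢⇔ = nth-≢ {k} {v} π (proj₁ v∈)
          ×⇔ = AllIx-× {Fits p h r} π
          all⇔ = AllIx-cong a (λ i i<l → step⇔ i (subst (i <_) l i<l))
      in mk⇔ (λ (g , ≢v) → Equivalence.to all⇔ (Equivalence.to ×⇔ (g , Equivalence.to ≢⇔ ≢v)))
             (λ g → let g′ , a′ = Equivalence.from ×⇔ (Equivalence.from all⇔ g)
                    in g′ , Equivalence.from ≢⇔ a′))
    (goodCount-graft p h r k≤m v∈ fits fits⇔))

-- Splits by the entry at position `k`, which the window confines to the values from `a` to `b`, and
-- deletes that entry.
goodCount-fibres : ∀ p h r {p′ h′ k a b m} → k ≤ m →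
  (∀ {x} → InRange (suc m) x → Fits p h r k x → a ≤ x × x ≤ b) →
  (∀ {v} → a ≤ v → v ≤ b → InRange (suc m) v × Fits p h r k v ×
     (∀ i {y} → i < m → InRange m y → Fits p h r (relabel k i) (relabel v y) ⇔ Fits p′ h′ v i y)) →
  goodCount p h r (suc m) ≡ sumRange a b (λ v → goodCount p′ h′ v m)
goodCount-fibres p h r {k = k} {a} {b} {m} k≤m bounds fits = trans
  (count-fibres (good? p h r) (nth k) (range a b) (Sym (suc m)) (range-unique a b)
    λ {π} π∈ g → let _ , all , l = ∈-Sym⁻ π∈
                     k<l = subst (k <_) (sym l) (s≤s k≤m)
                     a≤ , ≤b = bounds (All-nth k<l all) (AllIx-nth π k<l g)
                 in ∈-range⁺ a≤ ≤b)
  (cong sum (map-cong-local (All.tabulate λ v∈ →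
    let a≤v , v≤b = ∈-range⁻ v∈
        v∈′ , f , f⇔ = fits a≤v v≤b
    in goodCount-graft p h r k≤m v∈′ f f⇔)))

-- Windows before and after a deletion

≤-+-suc : ∀ {w} i h → w ≤ i + suc h ⇔ w ≤ suc (i + h)
≤-+-suc {w} i h = mk⇔ (subst (w ≤_) (+-suc i h)) (subst (w ≤_) (sym (+-suc i h)))

-- The subscripts tell which of p and h is shifted: Window₁₀ p h is the
-- condition of Fits (suc p) h, and so on.
Window₁₁ Window₁₀ Window₀₁ : (p h i w : ℕ) → Set
Window₁₁ p h i w = w ≤ suc (suc (i + h)) × i < w + p
Window₁₀ p h i w = w ≤ suc (i + h)       × i < w + p
Window₀₁ p h i w = w ≤ suc (suc (i + h)) × suc i < w + p

lower⇔ : ∀ {i} w p → suc i < w + suc p ⇔ i < w + p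
lower⇔ w p = mk⇔ (s≤s⁻¹ ∘ Equivalence.to (≤-+-suc w p)) (Equivalence.from (≤-+-suc w p) ∘ s≤s)

Fits⇔₁₁ : ∀ p h r i x → Fits (suc p) (suc h) r i x ⇔ Window₁₁ p h i (relabel r x)
Fits⇔₁₁ p h r i x = ≤-+-suc (suc i) h ×-⇔ lower⇔ (relabel r x) p

Fits⇔₁₀ : ∀ p h r i x → Fits (suc p) h r i x ⇔ Window₁₀ p h i (relabel r x)
Fits⇔₁₀ p h r i x = ⇔-id _ ×-⇔ lower⇔ (relabel r x) p

Fits⇔₀₁ : ∀ p h r i x → Fits p (suc h) r i x ⇔ Window₀₁ p h i (relabel r x)
Fits⇔₀₁ p h r i x = ≤-+-suc (suc i) h ×-⇔ ⇔-id _

data Side (r x : ℕ) : Set where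
  lt : x < r → relabel r x ≡ x → Side r x
  ge : r ≤ x → relabel r x ≡ suc x → Side r x

side : ∀ r x → Side r x
side r x with x <? r
... | yes x<r = lt x<r (relabel-below x<r)
... | no x≮r  = ge (≮⇒≥ x≮r) (relabel-above (≮⇒≥ x≮r))

true⇔ : {A B : Set} → A → B → A ⇔ B
true⇔ a b = mk⇔ (λ _ → b) (λ _ → a)

false⇔ : {A B : Set} → ¬ A → ¬ B → A ⇔ B
false⇔ ¬a ¬b = mk⇔ (λ a → contradiction a ¬a) (λ b → contradiction b ¬b)

suc⇔ : ∀ {m n} → suc m ≤ suc n ⇔ m ≤ n
suc⇔ = mk⇔ s≤s⁻¹ s≤s

-- Only the chip `x = r` is relabelled differently, `suc r` becoming `r`. Its upper bound holds
-- either way since `r ≤ h`; its lower bound changes from `i ≤ r + p` to `i < r + p`.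
small-step : ∀ {r h p i x} → r ≤ h →
  (Window₁₁ p h i (relabel r x) × ¬ (i ≡ r + p × x ≡ r)) ⇔ Window₁₁ p h i (relabel (suc r) x)
small-step {r} {h} {p} {i} {x} r≤h with <-cmp x r
... | tri< x<r _ _ rewrite relabel-below x<r | relabel-below (m≤n⇒m≤1+n x<r) =
  mk⇔ proj₁ (λ w → w , λ (_ , x≡r) → <⇒≢ x<r x≡r)
... | tri> _ _ r<x rewrite relabel-above (<⇒≤ r<x) | relabel-above r<x =
  mk⇔ proj₁ (λ w → w , λ (_ , x≡r) → <⇒≢ r<x (sym x≡r))
... | tri≈ _ refl _ rewrite relabel-above (≤-refl {r}) | relabel-below (n<1+n r) = mk⇔
  (λ ((u , l) , ≢) → <⇒≤ u , ≤∧≢⇒< (s≤s⁻¹ l) (λ i≡ → ≢ (i≡ , refl)))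
  (λ (_ , l) → (s≤s (≤-trans r≤h (m≤n⇒m≤1+n (m≤n+m h i))) , m≤n⇒m≤1+n l) ,
    λ (i≡ , _) → <-irrefl i≡ l)

-- If only the value shifts, the upper bound tightens by one, which is the drop in `h`, and the
-- lower bound is automatic. If value and index both shift, the lower bound is preserved and the
-- upper one is automatic. A small value at a shifted index fails on both sides.
small-graft : ∀ {r h y p i} → r ≤ h → y ≤ h + p →
  Window₁₁ p h (relabel (r + p) i) (relabel r (relabel r y)) ⇔ Window₁₀ p h i (relabel r y)
small-graft {r} {h} {y} {p} {i} r≤h y≤m with side r y | side (r + p) i
... | lt y<r e | lt i<k e′ rewrite e′ | e | e =
  true⇔ (≤-trans y≤ (n≤1+n _)) y≤ ×-⇔ ⇔-id _
  where y≤ : y ≤ suc (i + h)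
        y≤ = ≤-trans (<⇒≤ y<r) (≤-trans r≤h (m≤n⇒m≤1+n (m≤n+m h i)))
... | lt y<r e | ge k≤i e′ rewrite e′ | e | e =
  false⇔ (λ (_ , l) → <⇒≱ l (≤-trans y+p≤i (n≤1+n i))) (λ (_ , l) → <⇒≱ l y+p≤i)
  where y+p≤i = ≤-trans (+-monoˡ-≤ p (<⇒≤ y<r)) k≤i
... | ge r≤y e | lt i<k e′ rewrite e′ | e | relabel-above (m≤n⇒m≤1+n r≤y) =
  suc⇔ ×-⇔ true⇔ (m≤n⇒m≤1+n (m≤n⇒m≤1+n i<)) (m≤n⇒m≤1+n i<)
  where i< = ≤-trans i<k (+-monoˡ-≤ p r≤y)
... | ge r≤y e | ge k≤i e′ rewrite e′ | e | relabel-above (m≤n⇒m≤1+n r≤y) =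
  true⇔ (s≤s (s≤s (m≤n⇒m≤1+n y≤))) (s≤s y≤) ×-⇔ suc⇔
  where y≤ : y ≤ i + h
        y≤ = ≤-trans y≤m (subst (h + p ≤_) (+-comm h i) (+-monoʳ-≤ h (≤-trans (m≤n+m p r) k≤i)))

-- Deleting the last site shifts no index. A shifted value accounts for the drop in `h`; an
-- unshifted one is at most `h` and meets both upper bounds.
small-last : ∀ {h v i p y} → h < v → i < h + p →
  Window₁₁ p h (relabel (h + p) i) (relabel (suc h) (relabel v y)) ⇔ Window₁₀ p h i (relabel v y)
small-last {h} {v} {i} {p} {y} h<v i<m with side v y | side (suc h) y
... | lt y<v e | lt y≤h e′ rewrite relabel-below i<m | e | e′ =
  true⇔ (≤-trans y≤ (n≤1+n _)) y≤ ×-⇔ ⇔-id _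
  where y≤ : y ≤ suc (i + h)
        y≤ = ≤-trans (s≤s⁻¹ y≤h) (m≤n⇒m≤1+n (m≤n+m h i))
... | lt y<v e | ge h<y e′ rewrite relabel-below i<m | e | e′ =
  suc⇔ ×-⇔ true⇔ (m≤n⇒m≤1+n i<) i<
  where i< = ≤-trans i<m (+-monoˡ-≤ p (<⇒≤ h<y))
... | ge v≤y e | _ rewrite relabel-below i<m | e | relabel-above (≤-trans h<v (m≤n⇒m≤1+n v≤y)) =
  suc⇔ ×-⇔ true⇔ (m≤n⇒m≤1+n (m≤n⇒m≤1+n i<)) (m≤n⇒m≤1+n i<)
  where i< = ≤-trans i<m (+-monoˡ-≤ p (≤-trans (<⇒≤ h<v) v≤y))

-- The mirror of `small-step`: for the chip `s` the lower bound is automatic, and the upper bound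
-- changes from `k ≤ i` to `k < i`.
large-step : ∀ {i h p k x} → i ≤ h + p → let s = suc (suc (k + h)) in
  (Window₁₁ p h i (relabel (suc s) x) × ¬ (i ≡ k × x ≡ s)) ⇔ Window₁₁ p h i (relabel s x)
large-step {i} {h} {p} {k} {x} i≤m with <-cmp x (suc (suc (k + h)))
... | tri< x<s _ _ rewrite relabel-below x<s | relabel-below (m≤n⇒m≤1+n x<s) =
  mk⇔ proj₁ (λ w → w , λ (_ , x≡s) → <⇒≢ x<s x≡s)
... | tri> _ _ s<x rewrite relabel-above (<⇒≤ s<x) | relabel-above s<x =
  mk⇔ proj₁ (λ w → w , λ (_ , x≡s) → <⇒≢ s<x (sym x≡s))
... | tri≈ _ refl _
  rewrite relabel-above (≤-refl {suc (suc (k + h))})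
        | relabel-below (n<1+n (suc (suc (k + h)))) = mk⇔
  (λ ((u , l) , ≢) →
    let k≤i = +-cancelʳ-≤ h k i (s≤s⁻¹ (s≤s⁻¹ u)) in
    s≤s (s≤s (+-monoˡ-≤ h (≤∧≢⇒< k≤i (λ k≡i → ≢ (sym k≡i , refl))))) , m≤n⇒m≤1+n l)
  (λ (u , _) → (<⇒≤ u , ≤-<-trans i≤m (+-monoˡ-< p (s≤s (m≤n⇒m≤1+n (m≤n+m h k))))) ,
    λ { (refl , _) → <-irrefl refl u })

-- The mirror of `small-graft`: a shifted index with an unshifted value tightens the lower bound,
-- which is the drop in `p`. A large value before the deleted site fails on both sides.
large-graft : ∀ {k p i h y} → k < p → i < h + p → let s = suc (suc (k + h)) in
  Window₁₁ p h (relabel k i) (relabel (suc s) (relabel s y)) ⇔ Window₀₁ p h i (relabel s y)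
large-graft {k} {p} {i} {h} {y} k<p i<m with side (suc (suc (k + h))) y | side k i
... | lt y<s e | lt i<k e′ rewrite e′ | e | relabel-below (m≤n⇒m≤1+n y<s) =
  ⇔-id _ ×-⇔ true⇔ (<⇒≤ i<) i<
  where i< : suc i < y + p
        i< = ≤-trans (s≤s i<k) (≤-trans k<p (m≤n+m p y))
... | lt y<s e | ge k≤i e′ rewrite e′ | e | relabel-below (m≤n⇒m≤1+n y<s) =
  true⇔ (m≤n⇒m≤1+n y≤) y≤ ×-⇔ ⇔-id _
  where y≤ : y ≤ suc (suc (i + h))
        y≤ = ≤-trans (<⇒≤ y<s) (s≤s (s≤s (+-monoˡ-≤ h k≤i)))
... | ge s≤y e | lt i<k e′ rewrite e′ | e | relabel-above (s≤s s≤y) =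
  false⇔ (λ (u , _) → <⇒≱ y> (<⇒≤ (<⇒≤ u))) (λ (u , _) → <⇒≱ y> (<⇒≤ u))
  where y> : suc (suc (i + h)) < y
        y> = ≤-trans (s≤s (s≤s (+-monoˡ-≤ h i<k))) s≤y
... | ge s≤y e | ge k≤i e′ rewrite e′ | e | relabel-above (s≤s s≤y) =
  suc⇔ ×-⇔ true⇔ (s≤s (m≤n⇒m≤1+n i<)) (s≤s i<)
  where i< : suc i ≤ y + p
        i< = ≤-trans i<m (+-monoˡ-≤ p (≤-trans (m≤n⇒m≤1+n (m≤n⇒m≤1+n (m≤n+m h k))) s≤y))

-- Deleting the first site shifts every index, so values unmoved by the outer `relabel` see the drop
-- in `p`. For values it moves, the upper bounds correspond and the lower ones are automatic.
large-first : ∀ {v h i p y} → v ≤ suc h → i < h + p →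
  Window₁₁ p h (suc i) (relabel (suc (suc h)) (relabel v y)) ⇔ Window₀₁ p h i (relabel v y)
large-first {v} {h} {i} {p} {y} v≤ i<m with side v y | side (suc h) y
... | lt y<v e | _ rewrite e | relabel-below {suc (suc h)} (≤-trans y<v (m≤n⇒m≤1+n v≤)) =
  true⇔ (m≤n⇒m≤1+n y≤) y≤ ×-⇔ ⇔-id _
  where y≤ : y ≤ suc (suc (i + h))
        y≤ = ≤-trans (<⇒≤ y<v) (≤-trans v≤ (s≤s (m≤n⇒m≤1+n (m≤n+m h i))))
... | ge v≤y e | lt y≤h _ rewrite e | relabel-below (s≤s y≤h) =
  true⇔ (m≤n⇒m≤1+n y≤) y≤ ×-⇔ ⇔-id _
  where y≤ : suc y ≤ suc (suc (i + h))
        y≤ = ≤-trans y≤h (s≤s (m≤n⇒m≤1+n (m≤n+m h i)))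
... | ge v≤y e | ge h<y _ rewrite e | relabel-above (s≤s h<y) =
  suc⇔ ×-⇔ true⇔ (s≤s (m≤n⇒m≤1+n i<)) (s≤s i<)
  where i< : suc i ≤ y + p
        i< = ≤-trans i<m (+-monoˡ-≤ p (<⇒≤ h<y))

-- Summing the recurrences

sumRange-head : ∀ {a b} f → a ≤ b → sumRange a b f ≡ f a + sumRange (suc a) b f
sumRange-head {a} {b} f a≤b = cong (sum ∘ map f) (begin
  range a b                  ≡⟨ range≡from a b ⟩
  from a (suc b ∸ a)         ≡⟨ cong (from a) (+-∸-assoc 1 a≤b) ⟩
  a ∷ from (suc a) (b ∸ a)   ≡⟨ cong (a ∷_) (range≡from (suc a) b) ⟨
  a ∷ range (suc a) b        ∎)
  where open ≡-Reasoning

sumRange-last : ∀ b f → sumRange 1 (suc b) f ≡ sumRange 1 b f + f (suc b)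
sumRange-last b f = begin
  sum (map f (range 1 (suc b)))
    ≡⟨ cong (sum ∘ map f) (range≡from 1 (suc b)) ⟩
  sum (map f (from 1 (suc b)))
    ≡⟨ cong (sum ∘ map f) (from-∷ʳ 1 b) ⟩
  sum (map f (from 1 b ++ suc b ∷ []))
    ≡⟨ cong sum (map-++ f (from 1 b) _) ⟩
  sum (map f (from 1 b) ++ f (suc b) ∷ [])
    ≡⟨ sum-++ (map f (from 1 b)) _ ⟩
  sum (map f (from 1 b)) + (f (suc b) + 0)
    ≡⟨ cong₂ (λ xs y → sum (map f xs) + y) (sym (range≡from 1 b)) (+-identityʳ _) ⟩
  sumRange 1 b f + f (suc b) ∎
  where open ≡-Reasoning

module _ (p h : ℕ) where
  private
    m = h + p
    p₁ = suc p
    h₁ = suc h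

  small-recurrence : ∀ {r} → 1 ≤ r → r ≤ h →
    goodCount p₁ h₁ r (suc m) ≡ goodCount p₁ h₁ (suc r) (suc m) + goodCount p₁ h r m
  small-recurrence {r} 1≤r r≤h = goodCount-step p₁ h₁ r (suc r)
    (+-monoˡ-≤ p r≤h)
    (1≤r , m≤n⇒m≤1+n (≤-trans r≤h (m≤m+n h p)))
    (λ i {x} _ _ → ⇔-sym (Fits⇔₁₁ p h (suc r) i x) ⇔-∘
      (small-step r≤h ⇔-∘ (Fits⇔₁₁ p h r i x ×-⇔ ⇔-id _)))
    (Equivalence.from (Fits⇔₁₁ p h r (r + p) r)
      (subst (Window₁₁ p h (r + p)) (sym (relabel-above ≤-refl))
        -- The deleted chip meets its lower bound with equality.
        (s≤s (m≤n⇒m≤1+n (≤-trans (m≤m+n r p) (m≤m+n _ h))) , ≤-refl)))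
    (λ i {y} _ (_ , y≤m) → ⇔-sym (Fits⇔₁₀ p h r i y) ⇔-∘ (small-graft r≤h y≤m ⇔-∘
      Fits⇔₁₁ p h r (relabel (r + p) i) (relabel r y)))

  small-base : goodCount p₁ h₁ h₁ (suc m) ≡ sumRange h₁ (suc m) (λ v → goodCount p₁ h v m)
  small-base = goodCount-fibres p₁ h₁ h₁ ≤-refl
    (λ {x} (_ , x≤) f → h₁≤ {x} (Equivalence.to (Fits⇔₁₁ p h h₁ m x) f) , x≤)
    (λ {v} h₁≤v v≤ → (≤-trans (s≤s z≤n) h₁≤v , v≤) ,
      Equivalence.from (Fits⇔₁₁ p h h₁ m v)
        (subst (Window₁₁ p h m) (sym (relabel-above h₁≤v))
          (s≤s (≤-trans v≤ (s≤s (m≤m+n m h))) , s≤s (+-monoˡ-≤ p (<⇒≤ h₁≤v)))) ,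
      λ i {y} i<m _ → ⇔-sym (Fits⇔₁₀ p h v i y) ⇔-∘ (small-last h₁≤v i<m ⇔-∘
        Fits⇔₁₁ p h h₁ (relabel m i) (relabel v y)))
    where
    -- At the last index `m = h + p` the lower bound reads `h < w`.
    h₁≤ : ∀ {x} → Window₁₁ p h m (relabel h₁ x) → h₁ ≤ x
    h₁≤ {x} (_ , l) = ≮⇒≥ λ x<h₁ →
      <⇒≱ (+-cancelʳ-< p h x (subst (λ w → m < w + p) (relabel-below x<h₁) l)) (s≤s⁻¹ x<h₁)

  -- Descending induction from the base `r = h₁`, with `d` the distance to it; each step down
  -- contributes the summand for `r`.
  small-sum : ∀ {r} d → d + r ≡ h₁ → 1 ≤ r →
    goodCount p₁ h₁ r (suc m) ≡ sumRange r (suc m) (λ v → goodCount p₁ h v m)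
  small-sum zero    refl _ = small-base
  small-sum {r} (suc d) e 1≤r = begin
    goodCount p₁ h₁ r (suc m)
      ≡⟨ small-recurrence 1≤r r≤h ⟩
    goodCount p₁ h₁ (suc r) (suc m) + goodCount p₁ h r m
      ≡⟨ cong (_+ goodCount p₁ h r m) (small-sum d (trans (+-suc d r) e) (s≤s z≤n)) ⟩
    sumRange (suc r) (suc m) f + f r
      ≡⟨ +-comm _ (f r) ⟩
    f r + sumRange (suc r) (suc m) f
      ≡⟨ sumRange-head f (m≤n⇒m≤1+n (≤-trans r≤h (m≤m+n h p))) ⟨
    sumRange r (suc m) f ∎
    where
    open ≡-Reasoning
    f = λ v → goodCount p₁ h v m
    r≤h : r ≤ h
    r≤h = subst (r ≤_) (suc-injective e) (m≤n+m r d)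

  large-recurrence : ∀ k → k < p → let s = suc (suc (k + h)) in
    goodCount p₁ h₁ (suc s) (suc m) ≡ goodCount p₁ h₁ s (suc m) + goodCount p h₁ s m
  large-recurrence k k<p = goodCount-step p₁ h₁ (suc s) s
    (≤-trans (<⇒≤ k<p) (m≤n+m p h))
    (s≤s z≤n , s≤s (subst (suc (k + h) ≤_) (+-comm p h) (+-monoˡ-≤ h k<p)))
    (λ i {x} i< _ → ⇔-sym (Fits⇔₁₁ p h s i x) ⇔-∘
      (large-step {k = k} (s≤s⁻¹ i<) ⇔-∘ (Fits⇔₁₁ p h (suc s) i x ×-⇔ ⇔-id _)))
    (Equivalence.from (Fits⇔₁₁ p h (suc s) k s)
      (subst (Window₁₁ p h k) (sym (relabel-below (n<1+n s)))
        (≤-refl , s≤s (m≤n⇒m≤1+n (≤-trans (m≤m+n k h) (m≤m+n _ p))))))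
    (λ i {y} i<m _ → ⇔-sym (Fits⇔₀₁ p h s i y) ⇔-∘ (large-graft {y = y} k<p i<m ⇔-∘
      Fits⇔₁₁ p h (suc s) (relabel k i) (relabel s y)))
    where s = suc (suc (k + h))

  large-base : goodCount p₁ h₁ (suc h₁) (suc m) ≡ sumRange 1 h₁ (λ v → goodCount p h₁ v m)
  large-base = goodCount-fibres p₁ h₁ (suc h₁) z≤n
    (λ {x} (1≤x , _) f → 1≤x , ≤h₁ {x} (Equivalence.to (Fits⇔₁₁ p h (suc h₁) 0 x) f))
    (λ {v} 1≤v v≤h₁ → (1≤v , ≤-trans v≤h₁ (s≤s (m≤m+n h p))) ,
      Equivalence.from (Fits⇔₁₁ p h (suc h₁) 0 v)
        (subst (Window₁₁ p h 0) (sym (relabel-below (s≤s v≤h₁)))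
          (m≤n⇒m≤1+n v≤h₁ , ≤-trans 1≤v (m≤m+n v p))) ,
      λ i {y} i<m _ → ⇔-sym (Fits⇔₀₁ p h v i y) ⇔-∘ (large-first v≤h₁ i<m ⇔-∘
        Fits⇔₁₁ p h (suc h₁) (suc i) (relabel v y)))
    where
    ≤h₁ : ∀ {x} → Window₁₁ p h 0 (relabel (suc h₁) x) → x ≤ h₁
    ≤h₁ {x} (u , _) = ≮⇒≥ λ h₁<x → <⇒≱ h₁<x (s≤s⁻¹ (subst (_≤ suc h₁) (relabel-above h₁<x) u))

  -- Ascending induction from the base `r = h₁ + 1`, with `k` the excess of `r` over it; each step
  -- up contributes a new last summand.
  large-sum : ∀ k → k ≤ p → let s = suc (k + h) in
    goodCount p₁ h₁ (suc s) (suc m) ≡ sumRange 1 s (λ v → goodCount p h₁ v m)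
  large-sum zero    _   = large-base
  large-sum (suc k) k<p = begin
    goodCount p₁ h₁ (suc (suc s)) (suc m)
      ≡⟨ large-recurrence k k<p ⟩
    goodCount p₁ h₁ (suc s) (suc m) + f (suc s)
      ≡⟨ cong (_+ f (suc s)) (large-sum k (<⇒≤ k<p)) ⟩
    sumRange 1 s f + f (suc s)
      ≡⟨ sumRange-last s f ⟨
    sumRange 1 (suc s) f ∎
    where
    open ≡-Reasoning
    s = suc (k + h)
    f = λ v → goodCount p h₁ v m

cardT≡goodCount : ∀ {n p h r} → suc n ≡ p + h → 1 ≤ p → 1 ≤ h → InRange (suc n) r →
                  cardT n r p ≡ goodCount p h r n
cardT≡goodCount {n} {p} {h} {r} n≡ 1≤p 1≤h r∈ =
  count-cong (InT? n r p) (good? p h r) (Sym n) λ π∈ → InT⇔Good n≡ 1≤p 1≤h r∈ (∈-Sym⁻ π∈)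

sumRange-cong : ∀ {a b f g} → (∀ {v} → a ≤ v → v ≤ b → f v ≡ g v) → sumRange a b f ≡ sumRange a b g
sumRange-cong f≡g = cong sum (map-cong-local (All.tabulate λ v∈ →
  let a≤v , v≤b = ∈-range⁻ v∈ in f≡g a≤v v≤b))

theorem4p8 : (n p r : ℕ) → 2 ≤ n → 1 ≤ p → p ≤ n → 1 ≤ r → r ≤ suc n →
    ((r ≤ n ∸ p + 1 → p ≤ n ∸ 1 →
    cardT n r p ≡ sumRange r n (λ i → cardT (n ∸ 1) i p))
    × (n ∸ p + 1 < r → 2 ≤ p →
    cardT n r p ≡ sumRange 1 (r ∸ 1) (λ i → cardT (n ∸ 1) i (p ∸ 1))))
theorem4p8 (suc m) (suc p) r 2≤n 1≤p (s≤s p≤m) 1≤r r≤ with m ∸ p | m∸n+n≡m p≤m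
... | h | refl = small , large
  where
  open ≡-Reasoning
  -- Here `h` is `n - p` in the original variables, so the number of passes is `suc h`.
  n≡ : suc (suc m) ≡ suc p + suc h
  n≡ = cong suc (trans (cong suc (+-comm h p)) (sym (+-suc p h)))

  cardT≡ : cardT (suc m) r (suc p) ≡ goodCount (suc p) (suc h) r (suc m)
  cardT≡ = cardT≡goodCount n≡ (s≤s z≤n) (s≤s z≤n) (1≤r , r≤)

  small : r ≤ h + 1 → suc p ≤ m →
          cardT (suc m) r (suc p) ≡ sumRange r (suc m) (λ i → cardT m i (suc p))
  small r≤h p<m = begin
    cardT (suc m) r (suc p)
      ≡⟨ cardT≡ ⟩
    goodCount (suc p) (suc h) r (suc m)
      ≡⟨ small-sum p h (suc h ∸ r) (m∸n+n≡m (subst (r ≤_) (+-comm h 1) r≤h)) 1≤r ⟩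
    sumRange r (suc m) (λ v → goodCount (suc p) h v m)
      -- The smaller problem has `h` passes, and `p ≤ n - 1` makes `h` positive.
      ≡⟨ sumRange-cong (λ r≤v v≤ → cardT≡goodCount (cong suc (+-comm h p)) (s≤s z≤n)
           (+-cancelʳ-≤ p 1 h p<m) (≤-trans 1≤r r≤v , v≤)) ⟨
    sumRange r (suc m) (λ i → cardT m i (suc p)) ∎

  large : h + 1 < r → 2 ≤ suc p →
          cardT (suc m) r (suc p) ≡ sumRange 1 (r ∸ 1) (λ i → cardT m i p)
  large h<r 2≤p with m≤n⇒∃[o]m+o≡n (subst (_< r) (+-comm h 1) h<r)
  ... | k , refl = begin
    cardT (suc m) r (suc p)
      ≡⟨ cardT≡ ⟩
    goodCount (suc p) (suc h) r (suc m)
      ≡⟨ cong (λ j → goodCount (suc p) (suc h) (suc (suc j)) (suc m)) (+-comm h k) ⟩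
    goodCount (suc p) (suc h) (suc (suc (k + h))) (suc m)
      ≡⟨ large-sum p h k (+-cancelˡ-≤ h k p (s≤s⁻¹ (s≤s⁻¹ r≤))) ⟩
    sumRange 1 (suc (k + h)) (λ v → goodCount p (suc h) v m)
      ≡⟨ cong (λ j → sumRange 1 (suc j) (λ v → goodCount p (suc h) v m)) (+-comm k h) ⟩
    sumRange 1 (r ∸ 1) (λ v → goodCount p (suc h) v m)
      -- Here `p` loses one instead, and `2 ≤ p` keeps the new value positive.
      ≡⟨ sumRange-cong (λ 1≤v v≤ → cardT≡goodCount (suc-injective n≡) (s≤s⁻¹ 2≤p) (s≤s z≤n)
           (1≤v , ≤-trans v≤ (s≤s⁻¹ r≤))) ⟨
    sumRange 1 (r ∸ 1) (λ i → cardT m i p) ∎
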